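{- The two-player stochastic games with $n$ states are characterized by the collection of USOs $\phi^F$, where $\phi$ is an LP-USO of an $n$-grid and $F\subseteq[n]$. That is, for $a\in\mathbb N^n$ with $a_j\ge2$ for all $j$, an orientation $\psi$ of the grid $G(a)$ arises from some nondegenerate two-player stochastic game with perfect information of type $a$ if and only if $\psi=\phi^F$ for some LP-USO $\phi$ of $G(a)$ and some $F\subseteq[n]$, where $\phi^F$ is obtained from $\phi$ by reversing all edges in directions $j\in F$.
   Context: Write $[n]=\{1,\dots,n\}$; $\mathbf 1$ is the all-ones vector. A block matrix of type $b=(b_1,\dots,b_n)$ ($b_j$ positive integers) is a real $m\times n$ matrix, $m=\sum_jb_j$, whose rows are partitioned into $n$ consecutive blocks, block $j$ having $b_j$ rows; rows are indexed by $N(b)=\{(j,i): j\in[n], i\in[b_j]\}$. $B\subseteq N(b)$ is maximal complementary if it contains exactly one $(j,i)$ for each $j$. $E(b)$ is the block matrix of type $b$ whose row $(j,i)$ is the $j$-th unit row vector, for all $(j,i)$. The grid $G(b)$ is the graph whose vertices are the maximal complementary subsets of $N(b)$, two being adjacent if they differ in exactly one element; an edge $\{B,(B\setminus\{(j,i)\})\cup\{(j,k)\}\}$ has direction $j$. A subgrid is the subgraph induced by the vertices contained in some subset of $N(b)$. A unique-sink orientation (USO) is an orientation of the edges such that every (nonempty) subgrid has a unique sink. LP-USO: for a block matrix $M$ of type $b$, let $A=[M^T|I]$ be the $n\times(m+n)$ matrix with columns indexed by $N(b+\mathbf 1)$, column $(j,i)$, $i\le b_j$, being the transpose of row $(j,i)$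 of $M$ and column $(j,b_j+1)$ the $j$-th unit vector. A Grid-LP is an LP $\min q^Tu$ s.t. $M^Tu\le p$, $u\ge\mathbf 0$ such that $A_B$ is nonsingular with $A_B^{ -1}p>\mathbf 0$ for every maximal complementary $B\subseteq N(b+\mathbf 1)$. Let $c=[q|\mathbf 0]$ (entry $q^j_i$ at $(j,i)$, $i\le b_j$, and $0$ at $(j,b_j+1)$). It induces the orientation of $G(b+\mathbf 1)$ in which, for adjacent $B$ and $C=(B\setminus\{(j,i)\})\cup\{(j,k)\}$, $B\to C$ iff $(c_N^T-c_B^TA_B^{ -1}A_N)^j_k<0$, where $N=N(b+\mathbf 1)\setminus B$; all these reduced-cost entries are assumed nonzero (dual nondegeneracy). An LP-USO is a USO of a grid arising in this way from a Grid-LP. Two-player stochastic game of type $a$: $n$ states partitioned as $[n]=S_{\max}\cup S_{\min}$; state $j$ has actions $i\in[a_j]$ with rewards $r^j_i\in\mathbb R$ and transition probabilities $p^j_{ik}\ge0$, $\sum_kp^j_{ik}=1$; discount factor $\gamma\in[0,1)$. Let $P=(p^j_{ik})$, $r=(r^j_i)$ be the corresponding block matrix and vector of type $a$, $C=\{(j,a_j): j\in[n]\}$, $\overline C=N(a)\setminus C$, $S=\mathrm{diag}(s_{jj})$ with $s_{jj}=1$ for $j\in S_{\max}$ and $s_{jj}=-1$ for $j\in S_{\min}$, and $\mathbf S$ the block diagonal matrix with $j$-th block $s_{jj}I$ of order $a_j-1$. Put $M'=(E(a-\mathbf 1)-\gamma P_{\overline C})(I-\gamma P_C)^{ -1}$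 and $q'=M'r_C-r_{\overline C}$, and $M''=\mathbf SM'S$, $q''=\mathbf Sq'$. Let $[I|-M'']$ be the matrix with columns indexed by $N(a)$, column $(j,i)$, $i\le a_j-1$, being the unit vector $e_{(j,i)}$ and column $(j,a_j)$ minus the $j$-th column of $M''$. The USO arising from the game is the orientation of $G(a)$ in which $B\to C'=(B\setminus\{(j,i)\})\cup\{(j,k)\}$ iff $([I|-M'']_N^{ -1}q'')^j_k<0$, where $N=N(a)\setminus B$. The game is nondegenerate if none of these entries is zero. -}

module Defs where

open import Level using (Level; _⊔_; 0ℓ) renaming (suc to lsuc)
open import Algebra.Bundles using (CommutativeRing)
import Algebra.Definitions.RawMonoid as RawMonoidSum
open import Data.Nat.Base using (ℕ; suc)
open import Data.Fin.Base using (Fin; fromℕ; inject₁; punchIn)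
open import Data.Fin.Properties using (_≟_)
open import Data.Fin.Relation.Unary.Top using (view; ‵fromℕ; ‵inject₁)
open import Data.Fin.Subset using (Subset; _∈_; _∉_)
open import Data.Fin.Subset.Properties using (_∈?_)
open import Data.Product.Base using (Σ; Σ-syntax; ∃; _×_; _,_; proj₁; proj₂)
open import Data.Product.Properties using (≡-dec)
open import Data.Sum.Base using (_⊎_; inj₁; inj₂; swap)
open import Function.Base using (_∘_)
open import Function.Bundles using (_⇔_)
open import Relation.Binary.Core using (Rel)
open import Relation.Binary.Definitions using (DecidableEquality)
open import Relation.Binary.Structures using (IsStrictTotalOrder)
open import Relation.Binary.PropositionalEquality using (_≡_; _≢_; refl; sym; trans)
open import Relation.Nullary using (¬_; yes; no; contradiction)

-- The real numbers, axiomatised as a complete ordered field (classically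
-- unique up to isomorphism).

record CompleteOrderedField (c ℓ : Level) : Set (lsuc (c ⊔ ℓ)) where
  infix 4 _<_ _≤_
  field
    commutativeRing : CommutativeRing c ℓ
  open CommutativeRing commutativeRing public
  field
    _<_                : Rel Carrier ℓ
    isStrictTotalOrder : IsStrictTotalOrder _≈_ _<_
    0<1                : 0# < 1#
    +-monoʳ-<          : ∀ x {y z} → y < z → x + y < x + z
    *-pos              : ∀ {x y} → 0# < x → 0# < y → 0# < x * y
    inverse            : ∀ x → ¬ (x ≈ 0#) → ∃ λ y → x * y ≈ 1#

  _≤_ : Rel Carrier ℓ
  x ≤ y = x < y ⊎ x ≈ y

  IsUpperBound : (Carrier → Set (c ⊔ ℓ)) → Carrier → Set (c ⊔ ℓ)
  IsUpperBound P u = ∀ x → P x → x ≤ u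

  field
    supremum : (P : Carrier → Set (c ⊔ ℓ)) → ∃ P → ∃ (IsUpperBound P) →
               ∃ λ s → IsUpperBound P s × (∀ u → IsUpperBound P u → s ≤ u)

N : ∀ {n} → (Fin n → ℕ) → Set
N {n} b = Σ[ j ∈ Fin n ] Fin (b j)

_+𝟏 : ∀ {n} → (Fin n → ℕ) → (Fin n → ℕ)
(b +𝟏) j = suc (b j)

-- A maximal complementary subset {(j , B j) : j ∈ [n]} of N b is encoded
-- by its choice function B.
Vertex : ∀ {n} → (Fin n → ℕ) → Set
Vertex {n} b = (j : Fin n) → Fin (b j)

module _ {n : ℕ} {b : Fin n → ℕ} where

  infix 4 _≐ᵛ_ _∼[_]_

  -- Equality of the encoded subsets; function extensionality is not assumed.
  _≐ᵛ_ : Rel (Vertex b) 0ℓ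
  B ≐ᵛ C = ∀ j → B j ≡ C j

  -- {B , C} is an edge of direction j.
  _∼[_]_ : Vertex b → Fin n → Vertex b → Set
  B ∼[ j ] C = B j ≢ C j × (∀ l → l ≢ j → B l ≡ C l)

  _[_≔_] : Vertex b → (j : Fin n) → Fin (b j) → Vertex b
  (B [ j ≔ k ]) l with j ≟ l
  ... | yes refl = k
  ... | no  _    = B l

  direction-unique : ∀ {B C j j′} → B ∼[ j ] C → C ∼[ j′ ] B → j ≡ j′
  direction-unique {j = j} {j′} (Bj≢Cj , _) (_ , same) with j ≟ j′
  ... | yes j≡j′ = j≡j′
  ... | no  j≢j′ = contradiction (sym (same j j≢j′)) Bj≢Cj

  ∼-sym : ∀ {B C j} → B ∼[ j ] C → C ∼[ j ] B
  ∼-sym (differ , same) = differ ∘ sym , λ l l≢j → sym (same l l≢j)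

-- B ⟶ C says that {B , C} is an edge, directed from B to C.
record Orientation {n : ℕ} (b : Fin n → ℕ) : Set₁ where
  infix 4 _⟶_
  field
    _⟶_      : Rel (Vertex b) 0ℓ
    ⟶-resp   : ∀ {B B′ C C′} → B ≐ᵛ B′ → C ≐ᵛ C′ → B ⟶ C → B′ ⟶ C′
    ⟶-edge   : ∀ {B C} → B ⟶ C → ∃ λ j → B ∼[ j ] C
    ⟶-total  : ∀ {B C j} → B ∼[ j ] C → B ⟶ C ⊎ C ⟶ B
    ⟶-asym   : ∀ {B C} → B ⟶ C → ¬ (C ⟶ B)

module _ {n : ℕ} {b : Fin n → ℕ} where

  infix 4 _≐_

  _≐_ : Orientation b → Orientation b → Set
  φ ≐ ψ = ∀ B C → Orientation._⟶_ φ B C ⇔ Orientation._⟶_ ψ B C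

  infixl 8 _^_

  _^_ : Orientation b → Subset n → Orientation b
  φ ^ F = record
    { _⟶_     = _⇢_
    ; ⟶-resp  = resp
    ; ⟶-edge  = λ (j , e , _) → j , e
    ; ⟶-total = total
    ; ⟶-asym  = asym
    }
    where
    open Orientation φ

    _⇢_ : Rel (Vertex b) 0ℓ
    B ⇢ C = ∃ λ j → B ∼[ j ] C × ((j ∈ F × C ⟶ B) ⊎ (j ∉ F × B ⟶ C))

    resp : ∀ {B B′ C C′} → B ≐ᵛ B′ → C ≐ᵛ C′ → B ⇢ C → B′ ⇢ C′
    resp {B} {B′} {C} {C′} p q (j , (differ , same) , d) = j , (differ′ , same′) , d′ d
      where
      differ′ : B′ j ≢ C′ j
      differ′ eq = differ (trans (p j) (trans eq (sym (q j))))
      same′ : ∀ l → l ≢ j → B′ l ≡ C′ l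
      same′ l l≢j = trans (sym (p l)) (trans (same l l≢j) (q l))
      d′ : (j ∈ F × C ⟶ B) ⊎ (j ∉ F × B ⟶ C) → (j ∈ F × C′ ⟶ B′) ⊎ (j ∉ F × B′ ⟶ C′)
      d′ (inj₁ (j∈F , C⟶B)) = inj₁ (j∈F , ⟶-resp q p C⟶B)
      d′ (inj₂ (j∉F , B⟶C)) = inj₂ (j∉F , ⟶-resp p q B⟶C)

    total : ∀ {B C j} → B ∼[ j ] C → B ⇢ C ⊎ C ⇢ B
    total {j = j} e with j ∈? F | ⟶-total e
    ... | yes j∈F | inj₁ B⟶C = inj₂ (j , ∼-sym e , inj₁ (j∈F , B⟶C))
    ... | yes j∈F | inj₂ C⟶B = inj₁ (j , e , inj₁ (j∈F , C⟶B))
    ... | no  j∉F | inj₁ B⟶C = inj₁ (j , e , inj₂ (j∉F , B⟶C))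
    ... | no  j∉F | inj₂ C⟶B = inj₂ (j , ∼-sym e , inj₂ (j∉F , C⟶B))

    asym : ∀ {B C} → B ⇢ C → ¬ (C ⇢ B)
    asym (j , e , d) (j′ , e′ , d′) with direction-unique e e′
    asym (j , e , inj₁ (_ , C⟶B))   (_ , e′ , inj₁ (_ , B⟶C))   | refl = ⟶-asym B⟶C C⟶B
    asym (j , e , inj₁ (j∈F , _))   (_ , e′ , inj₂ (j∉F , _))   | refl = j∉F j∈F
    asym (j , e , inj₂ (j∉F , _))   (_ , e′ , inj₁ (j∈F , _))   | refl = j∉F j∈F
    asym (j , e , inj₂ (_ , B⟶C))   (_ , e′ , inj₂ (_ , C⟶B))   | refl = ⟶-asym B⟶C C⟶B

  -- A subset K of N b is given by its blocks K j ⊆ [b j]; it spans the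
  -- subgrid whose vertices are the B contained in K.
  _⊆ᵛ_ : Vertex b → (∀ j → Subset (b j)) → Set
  B ⊆ᵛ K = ∀ j → B j ∈ K j

  IsSink : Orientation b → (∀ j → Subset (b j)) → Vertex b → Set
  IsSink φ K B = B ⊆ᵛ K × (∀ C → C ⊆ᵛ K → ¬ (Orientation._⟶_ φ B C))

  IsUSO : Orientation b → Set
  IsUSO φ = ∀ K → ∃ (_⊆ᵛ K) →
            ∃ λ B → IsSink φ K B × (∀ C → IsSink φ K C → B ≐ᵛ C)

-- For a vertex B of the grid of type b + 𝟏, the complement N(b + 𝟏) ∖ B is
-- enumerated by N b: the k-th element of block j is the k-th element of
-- [b j + 1] different from B j.
module _ {n : ℕ} {b : Fin n → ℕ} where

  basic : Vertex (b +𝟏) → Fin n → N (b +𝟏)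
  basic B j = j , B j

  nonbasic : Vertex (b +𝟏) → N b → N (b +𝟏)
  nonbasic B (j , k) = j , punchIn (B j) k

  -- The neighbour of B obtained by exchanging the block-j element of B for
  -- the element nonbasic B (j , k).
  neighbour : Vertex (b +𝟏) → N b → Vertex (b +𝟏)
  neighbour B (j , k) = B [ j ≔ punchIn (B j) k ]

data Player : Set where
  max min : Player

module _ {c ℓ : Level} (ℝ : CompleteOrderedField c ℓ) where

  open CompleteOrderedField ℝ hiding (refl; sym; trans)
  open RawMonoidSum +-rawMonoid using (sum)

  record Index (I : Set) : Set c where
    field
      _≟ᴵ_ : DecidableEquality I
      ∑    : (I → Carrier) → Carrier

  open Index {{...}} using (_≟ᴵ_; ∑)

  instance
    Fin-index : ∀ {n} → Index (Fin n)
    Fin-index = record { _≟ᴵ_ = _≟_ ; ∑ = sum }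

    N-index : ∀ {n} {b : Fin n → ℕ} → Index (N b)
    N-index = record
      { _≟ᴵ_ = ≡-dec _≟_ _≟_
      ; ∑    = λ f → sum λ j → sum λ i → f (j , i)
      }

  Vect : Set → Set c
  Vect I = I → Carrier

  Matrix : Set → Set → Set c
  Matrix I J = I → J → Carrier

  infixl 7 _⊗_ _⊗ᵛ_ _⊙_
  infixl 6 _⊖_ _⊖ᵛ_

  _ᵀ : ∀ {I J} → Matrix I J → Matrix J I
  (A ᵀ) j i = A i j

  _⊗_ : ∀ {I J K} {{_ : Index J}} → Matrix I J → Matrix J K → Matrix I K
  (A ⊗ B) i k = ∑ λ j → A i j * B j k

  _⊗ᵛ_ : ∀ {I J} {{_ : Index J}} → Matrix I J → Vect J → Vect I
  (A ⊗ᵛ x) i = ∑ λ j → A i j * x j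

  _⊖_ : ∀ {I J} → Matrix I J → Matrix I J → Matrix I J
  (A ⊖ B) i j = A i j - B i j

  _⊖ᵛ_ : ∀ {I} → Vect I → Vect I → Vect I
  (x ⊖ᵛ y) i = x i - y i

  _⊙_ : ∀ {I J} → Carrier → Matrix I J → Matrix I J
  (t ⊙ A) i j = t * A i j

  neg : ∀ {I J} → Matrix I J → Matrix I J
  neg A i j = - A i j

  diag : ∀ {I} {{_ : Index I}} → Vect I → Matrix I I
  diag d i j with i ≟ᴵ j
  ... | yes _ = d i
  ... | no  _ = 0#

  𝟙 : ∀ {I} {{_ : Index I}} → Matrix I I
  𝟙 = diag λ _ → 1#

  -- Only square matrices are considered, so that an inverse is unique up to _≈_.
  record Inverse {I : Set} {{_ : Index I}} (A : Matrix I I) : Set (c ⊔ ℓ) where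
    field
      mat  : Matrix I I
      invˡ : ∀ i j → (mat ⊗ A) i j ≈ 𝟙 i j
      invʳ : ∀ i j → (A ⊗ mat) i j ≈ 𝟙 i j

  open Inverse using (mat)

  columns : ∀ {I J K} → Matrix I J → (K → J) → Matrix I K
  columns A f i k = A i (f k)

  -- The vector on N (b + 𝟏) whose entry at (j , i) is x (j , i) for i ≤ b j,
  -- and whose entry at (j , b j + 1) is y j.
  [_∣_]ᵛ : ∀ {n} {b : Fin n → ℕ} → Vect (N b) → Vect (Fin n) → Vect (N (b +𝟏))
  [ x ∣ y ]ᵛ (j , i) with view i
  ... | ‵fromℕ     = y j
  ... | ‵inject₁ k = x (j , k)

  [_∣_] : ∀ {I n} {b : Fin n → ℕ} →
          Matrix I (N b) → Matrix I (Fin n) → Matrix I (N (b +𝟏))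
  [ A ∣ B ] i = [ A i ∣ B i ]ᵛ

  E : ∀ {n} (b : Fin n → ℕ) → Matrix (N b) (Fin n)
  E b (j , i) = 𝟙 j

  -- The linear program  min qᵀu  subject to  Mᵀu ≤ p, u ≥ 0.
  record GridLP {n : ℕ} (b : Fin n → ℕ) : Set (c ⊔ ℓ) where
    field
      M : Matrix (N b) (Fin n)
      p : Vect (Fin n)
      q : Vect (N b)

    A : Matrix (Fin n) (N (b +𝟏))
    A = [ M ᵀ ∣ 𝟙 ]

    field
      A⁻¹      : ∀ B → Inverse (columns A (basic B))
      feasible : ∀ B j → 0# < (mat (A⁻¹ B) ⊗ᵛ p) j

    cost : Vect (N (b +𝟏))
    cost = [ q ∣ (λ _ → 0#) ]ᵛ

    -- c_Nᵀ − c_Bᵀ A_B⁻¹ A_N, with c_Bᵀ A_B⁻¹ A_N written as (A_B⁻¹ A_N)ᵀ c_B.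
    reducedCost : Vertex (b +𝟏) → Vect (N b)
    reducedCost B =
      (cost ∘ nonbasic B) ⊖ᵛ
      ((mat (A⁻¹ B) ⊗ columns A (nonbasic B)) ᵀ) ⊗ᵛ (cost ∘ basic B)

  record IsLPUSO {n : ℕ} {b : Fin n → ℕ} (φ : Orientation (b +𝟏)) : Set (c ⊔ ℓ) where
    open Orientation φ
    field
      lp             : GridLP b
    open GridLP lp
    field
      dualNondegenerate : ∀ B x → ¬ (reducedCost B x ≈ 0#)
      induced           : ∀ B x → (B ⟶ neighbour B x) ⇔ (reducedCost B x < 0#)
      isUSO             : IsUSO φ

  record Game {n : ℕ} (a : Fin n → ℕ) : Set (c ⊔ ℓ) where
    field
      owner : Fin n → Player
      r     : Vect (N a)
      P     : Matrix (N a) (Fin n)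
      P≥0   : ∀ x k → 0# ≤ P x k
      P-sum : ∀ x → ∑ (P x) ≈ 1#
      γ     : Carrier
      0≤γ   : 0# ≤ γ
      γ<1   : γ < 1#

  sign : Player → Carrier
  sign max = 1#
  sign min = - 1#

  module GameMatrices {n : ℕ} {b : Fin n → ℕ} (G : Game (b +𝟏)) where
    open Game G

    P-C : Matrix (Fin n) (Fin n)
    P-C j = P (j , fromℕ (b j))

    r-C : Vect (Fin n)
    r-C j = r (j , fromℕ (b j))

    P-C̅ : Matrix (N b) (Fin n)
    P-C̅ (j , i) = P (j , inject₁ i)

    r-C̅ : Vect (N b)
    r-C̅ (j , i) = r (j , inject₁ i)

    S : Matrix (Fin n) (Fin n)
    S = diag λ j → sign (owner j)

    𝐒 : Matrix (N b) (N b)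
    𝐒 = diag λ (j , _) → sign (owner j)

    module _ (K : Inverse (𝟙 ⊖ γ ⊙ P-C)) where

      M′ : Matrix (N b) (Fin n)
      M′ = (E b ⊖ γ ⊙ P-C̅) ⊗ mat K

      q′ : Vect (N b)
      q′ = M′ ⊗ᵛ r-C ⊖ᵛ r-C̅

      M″ : Matrix (N b) (Fin n)
      M″ = 𝐒 ⊗ M′ ⊗ S

      q″ : Vect (N b)
      q″ = 𝐒 ⊗ᵛ q′

      [I∣-M″] : Matrix (N b) (N (b +𝟏))
      [I∣-M″] = [ 𝟙 ∣ neg M″ ]

  -- ψ is the orientation arising from some nondegenerate game.  The inverse
  -- matrices of the definition always exist (as γ < 1) and are unique, so
  -- quantifying over them existentially only names them.
  record ArisesFromNondegenerateGame {n : ℕ} {b : Fin n → ℕ}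
           (ψ : Orientation (b +𝟏)) : Set (c ⊔ ℓ) where
    open Orientation ψ
    field
      game : Game (b +𝟏)
    open Game game
    open GameMatrices game
    field
      [I-γP-C]⁻¹ : Inverse (𝟙 ⊖ γ ⊙ P-C)
      [I∣-M″]⁻¹  : ∀ B → Inverse (columns ([I∣-M″] [I-γP-C]⁻¹) (nonbasic B))

    value : Vertex (b +𝟏) → Vect (N b)
    value B = mat ([I∣-M″]⁻¹ B) ⊗ᵛ q″ [I-γP-C]⁻¹

    field
      nondegenerate : ∀ B x → ¬ (value B x ≈ 0#)
      induced       : ∀ B x → (B ⟶ neighbour B x) ⇔ (value B x < 0#)

module Submission where

-- Put R = [Mᵀ ∣ I]ᵀ, so that the block-j rows of R are the columns of A in
-- block j.  Both orientations are read off residuals c − Ru with u chosen to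
-- annihilate the residual on the basis B: the reduced costs of a grid LP are
-- such residuals, and the complementary solution of a game is, up to the sign
-- of the owner, the residual for M = M′ and c = [q′ ∣ 0].
--
-- From a game, R = L L_C⁻¹ with L = E − γP, and every L_B is an M-matrix; so
-- p = (1ᵀL_C⁻¹)ᵀ makes (M′, p, q′) a grid LP, whose reduced costs agree with
-- the game up to the signs of the owners.
--
-- From a grid LP, every cost vector has an optimal vertex.  For each j, the
-- dual optimum y_j for the cost 1 on block j and 0 elsewhere satisfies
-- R y_j ≤ 0 outside block j, and minus the dual optimum for the cost −1
-- everywhere is a vector u with Ru > 0.  The matrix Y of the columns y_j is the transpose of an M-matrix, so
-- u = Yt with t > 0, and R Y diag(t) has the sign pattern and the positive row
-- sums of E − γP; scaling its rows gives a game.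

open import Defs
open import Level using (0ℓ; _⊔_) renaming (suc to lsuc)
import Algebra.Properties.AbelianGroup as AbelianGroupProperties
import Algebra.Properties.Ring as RingProperties
import Algebra.Properties.Semiring.Sum as SemiringSum
open import Data.Fin.Base using (Fin; zero; suc; toℕ; fromℕ; fromℕ<; inject₁; punchIn; punchOut)
open import Data.Fin.Properties
  using (_≟_; any?; punchInᵢ≢i; punchIn-punchOut; toℕ-fromℕ<; toℕ-injective; toℕ<n)
open import Data.Fin.Relation.Unary.Top using (view; ‵fromℕ; ‵inject₁; view-fromℕ; view-inject₁)
open import Data.Fin.Subset using (Subset; Side; inside; outside; _∈_; _∉_; ⊤)
open import Data.Fin.Subset.Properties using (_∈?_; ∈⊤)
open import Data.Nat.Base using (ℕ; zero; suc; z≤n)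
import Data.Nat.Base as ℕ
import Data.Nat.Properties as ℕ
open import Data.Product.Base using (Σ-syntax; ∃; _×_; _,_; proj₁; proj₂)
open import Data.Sum.Base using (inj₁; inj₂; [_,_])
import Data.Unit.Base as Unit
open import Data.Vec.Base using (tabulate)
open import Data.Vec.Functional using (insertAt; updateAt)
open import Data.Vec.Functional.Properties
  using (insertAt-lookup; insertAt-punchIn; updateAt-updates; updateAt-minimal)
open import Data.Vec.Properties using ([]=⇒lookup; lookup⇒[]=; lookup∘tabulate)
open import Function.Base using (_∘_)
open import Function.Bundles using (_⇔_; Equivalence; mk⇔)
open import Relation.Binary.Bundles using (StrictTotalOrder)
import Relation.Binary.Construct.StrictToNonStrict as StrictToNonStrict
open import Relation.Binary.Definitions using (tri<; tri≈; tri>)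
import Relation.Binary.Properties.StrictTotalOrder as STOProperties
open import Relation.Binary.PropositionalEquality as ≡ using (_≡_; _≢_)
import Relation.Binary.Reasoning.Setoid as SetoidReasoning
import Relation.Binary.Reasoning.StrictPartialOrder as SPOReasoning
open import Relation.Nullary using (¬_; Dec; yes; no; contradiction)

-- Conjugation with the signs of the owners only changes the sign of the complementary solution in
-- the blocks of the minimising player. The players thus enter through F alone, and what remains is
-- to compare grid LPs with the data (E - γP, r).
--
-- What makes grid LPs tractable is that all their basic solutions are positive: at every vertex,
-- pᵀy is a positive combination of the entries of Ry on that vertex. So an exchange at a violated
-- row lowers the cost without any ratio test, a vertex of least cost is dual feasible, and a
-- minimum over finitely many vertices takes the place of a duality theorem. The same fact makes p a
-- certificate that Yᵀ is an M-matrix.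
--
-- The definitions ask for explicit inverses. They come from such certificates: a positive vector
-- with positive image yields monotonicity, which in turn yields injectivity and the positive pivots
-- of an elimination.
--
-- The rows of R Y diag(t) have unequal sums, whereas those of E - γP all sum to 1 - γ. This is
-- repaired by positive row factors, which multiply the residuals by the same factors and so leave
-- the orientation alone.

module GridLPsAndGames {c ℓ} (ℝ : CompleteOrderedField c ℓ) where

  -- Ordered fields

  open CompleteOrderedField ℝ public hiding (zero)

  strictTotalOrder : StrictTotalOrder c ℓ ℓ
  strictTotalOrder = record { isStrictTotalOrder = isStrictTotalOrder }

  open StrictTotalOrder strictTotalOrder
    using (compare; strictPartialOrder; irrefl; asym; <-respˡ-≈; <-respʳ-≈)
    renaming (trans to <-trans)
  open STOProperties strictTotalOrder
    using (antisym)
    renaming (reflexive to ≤-reflexive; trans to ≤-trans; total to ≤-total)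
  module ≤-Reasoning = SPOReasoning strictPartialOrder
  open StrictToNonStrict _≈_ _<_ using () renaming (<-≤-trans to <≤; ≤-<-trans to ≤<)
  open AbelianGroupProperties +-abelianGroup using (⁻¹-anti-homo‿-)
  open RingProperties ring
    using (-‿distribˡ-*; -‿distribʳ-*; -1*x≈-x; -0#≈0#; -‿involutive; x∙y⁻¹≈ε⇒x≈y;
           x[y-z]≈xy-xz)
  open SemiringSum semiring
    using (sum; sum-cong-≋; sum-remove; ∑-distrib-+; *-distribˡ-sum; *-distribʳ-sum; sum-replicate-zero; sum-init-last)

  <-≤-trans : ∀ {x y z} → x < y → y ≤ z → x < z
  <-≤-trans = <≤ <-trans <-respʳ-≈

  ≤-<-trans : ∀ {x y z} → x ≤ y → y < z → x < z
  ≤-<-trans = ≤< sym <-trans <-respˡ-≈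

  ≮⇒≥ : ∀ {x y} → ¬ (x < y) → y ≤ x
  ≮⇒≥ {x} {y} x≮y with compare x y
  ... | tri< x<y _ _ = contradiction x<y x≮y
  ... | tri≈ _ x≈y _ = inj₂ (sym x≈y)
  ... | tri> _ _ y<x = inj₁ y<x

  ≰⇒> : ∀ {x y} → ¬ (x ≤ y) → y < x
  ≰⇒> {x} {y} x≰y with compare x y
  ... | tri< x<y _ _ = contradiction (inj₁ x<y) x≰y
  ... | tri≈ _ x≈y _ = contradiction (inj₂ x≈y) x≰y
  ... | tri> _ _ y<x = y<x

  ≤⇒≯ : ∀ {x y} → x ≤ y → ¬ (y < x)
  ≤⇒≯ x≤y y<x = irrefl refl (≤-<-trans x≤y y<x)

  +-monoˡ-< : ∀ z {x y} → x < y → x + z < y + z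
  +-monoˡ-< z {x} {y} x<y = <-respˡ-≈ (+-comm z x) (<-respʳ-≈ (+-comm z y) (+-monoʳ-< z x<y))

  +-monoʳ-≤ : ∀ z {x y} → x ≤ y → z + x ≤ z + y
  +-monoʳ-≤ z (inj₁ x<y) = inj₁ (+-monoʳ-< z x<y)
  +-monoʳ-≤ z (inj₂ x≈y) = inj₂ (+-congˡ x≈y)

  +-monoˡ-≤ : ∀ z {x y} → x ≤ y → x + z ≤ y + z
  +-monoˡ-≤ z (inj₁ x<y) = inj₁ (+-monoˡ-< z x<y)
  +-monoˡ-≤ z (inj₂ x≈y) = inj₂ (+-congʳ x≈y)

  +-mono-≤ : ∀ {x y u v} → x ≤ y → u ≤ v → x + u ≤ y + v
  +-mono-≤ x≤y u≤v = ≤-trans (+-monoˡ-≤ _ x≤y) (+-monoʳ-≤ _ u≤v)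

  +-mono-<-≤ : ∀ {x y u v} → x < y → u ≤ v → x + u < y + v
  +-mono-<-≤ x<y u≤v = <-≤-trans (+-monoˡ-< _ x<y) (+-monoʳ-≤ _ u≤v)

  +-mono-≤-< : ∀ {x y u v} → x ≤ y → u < v → x + u < y + v
  +-mono-≤-< x≤y u<v = ≤-<-trans (+-monoˡ-≤ _ x≤y) (+-monoʳ-< _ u<v)

  +-nonneg : ∀ {x y} → 0# ≤ x → 0# ≤ y → 0# ≤ x + y
  +-nonneg 0≤x 0≤y = ≤-trans (≤-reflexive (sym (+-identityˡ 0#))) (+-mono-≤ 0≤x 0≤y)

  [x-y]+y≈x : ∀ x y → (x - y) + y ≈ x
  [x-y]+y≈x x y = trans (+-assoc x (- y) y) (trans (+-congˡ (-‿inverseˡ y)) (+-identityʳ x))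

  [x+y]-y≈x : ∀ x y → (x + y) - y ≈ x
  [x+y]-y≈x x y = trans (+-assoc x y (- y)) (trans (+-congˡ (-‿inverseʳ y)) (+-identityʳ x))

  x<y⇒0<y-x : ∀ {x y} → x < y → 0# < y - x
  x<y⇒0<y-x {x} x<y = <-respˡ-≈ (-‿inverseʳ x) (+-monoˡ-< (- x) x<y)

  0<y-x⇒x<y : ∀ {x y} → 0# < y - x → x < y
  0<y-x⇒x<y {x} {y} lt = <-respˡ-≈ (+-identityˡ x) (<-respʳ-≈ ([x-y]+y≈x y x) (+-monoˡ-< x lt))

  x≤y⇒0≤y-x : ∀ {x y} → x ≤ y → 0# ≤ y - x
  x≤y⇒0≤y-x (inj₁ x<y) = inj₁ (x<y⇒0<y-x x<y)
  x≤y⇒0≤y-x {x} {y} (inj₂ x≈y) = inj₂ (trans (sym (-‿inverseʳ x)) (+-congʳ x≈y))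

  0≤y-x⇒x≤y : ∀ {x y} → 0# ≤ y - x → x ≤ y
  0≤y-x⇒x≤y (inj₁ lt) = inj₁ (0<y-x⇒x<y lt)
  0≤y-x⇒x≤y {x} {y} (inj₂ eq) = inj₂ (sym (x∙y⁻¹≈ε⇒x≈y y x (sym eq)))

  neg-antimono-< : ∀ {x y} → x < y → - y < - x
  neg-antimono-< {x} {y} x<y = 0<y-x⇒x<y (<-respʳ-≈
    (trans (+-comm y (- x)) (+-congˡ (sym (-‿involutive y)))) (x<y⇒0<y-x x<y))

  neg-antimono-≤ : ∀ {x y} → x ≤ y → - y ≤ - x
  neg-antimono-≤ (inj₁ x<y) = inj₁ (neg-antimono-< x<y)
  neg-antimono-≤ (inj₂ x≈y) = inj₂ (sym (-‿cong x≈y))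

  x≤0⇒0≤-x : ∀ {x} → x ≤ 0# → 0# ≤ - x
  x≤0⇒0≤-x x≤0 = ≤-trans (≤-reflexive (sym -0#≈0#)) (neg-antimono-≤ x≤0)

  x<0⇒0<-x : ∀ {x} → x < 0# → 0# < - x
  x<0⇒0<-x x<0 = <-respˡ-≈ -0#≈0# (neg-antimono-< x<0)

  0<x⇒-x<0 : ∀ {x} → 0# < x → - x < 0#
  0<x⇒-x<0 0<x = <-respʳ-≈ -0#≈0# (neg-antimono-< 0<x)

  *-monoˡ-< : ∀ {z x y} → 0# < z → x < y → z * x < z * y
  *-monoˡ-< {z} {x} {y} 0<z x<y =
    0<y-x⇒x<y (<-respʳ-≈ (x[y-z]≈xy-xz z y x) (*-pos 0<z (x<y⇒0<y-x x<y)))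

  *-monoˡ-≤ : ∀ {z x y} → 0# ≤ z → x ≤ y → z * x ≤ z * y
  *-monoˡ-≤ (inj₁ 0<z) (inj₁ x<y) = inj₁ (*-monoˡ-< 0<z x<y)
  *-monoˡ-≤ _          (inj₂ x≈y) = inj₂ (*-congˡ x≈y)
  *-monoˡ-≤ {z} {x} {y} (inj₂ 0≈z) _ =
    inj₂ (trans (*-congʳ (sym 0≈z)) (trans (zeroˡ x) (trans (sym (zeroˡ y)) (*-congʳ 0≈z))))

  *-monoʳ-≤ : ∀ {z x y} → 0# ≤ z → x ≤ y → x * z ≤ y * z
  *-monoʳ-≤ {z} {x} {y} 0≤z x≤y =
    ≤-trans (≤-reflexive (*-comm x z)) (≤-trans (*-monoˡ-≤ 0≤z x≤y) (≤-reflexive (*-comm z y)))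

  *-nonneg : ∀ {x y} → 0# ≤ x → 0# ≤ y → 0# ≤ x * y
  *-nonneg {x} 0≤x 0≤y = ≤-trans (≤-reflexive (sym (zeroʳ x))) (*-monoˡ-≤ 0≤x 0≤y)

  *-nonpos-nonneg : ∀ {x y} → x ≤ 0# → 0# ≤ y → x * y ≤ 0#
  *-nonpos-nonneg {x} {y} x≤0 0≤y = ≤-trans (*-monoʳ-≤ 0≤y x≤0) (≤-reflexive (zeroˡ y))

  *-antimonoˡ-≤ : ∀ {z x y} → z ≤ 0# → x ≤ y → z * y ≤ z * x
  *-antimonoˡ-≤ {z} {x} {y} z≤0 x≤y = 0≤y-x⇒x≤y
    (≤-trans (*-nonneg (x≤0⇒0≤-x z≤0) (x≤y⇒0≤y-x x≤y))
      (≤-reflexive eq))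
    where
    eq : - z * (y - x) ≈ z * x - z * y
    eq = begin
      - z * (y - x)             ≈⟨ x[y-z]≈xy-xz (- z) y x ⟩
      - z * y - - z * x         ≈⟨ +-cong (sym (-‿distribˡ-* z y)) (-‿cong (sym (-‿distribˡ-* z x))) ⟩
      - (z * y) - - (z * x)     ≈⟨ +-congˡ (-‿involutive (z * x)) ⟩
      - (z * y) + z * x         ≈⟨ +-comm _ _ ⟩
      z * x - z * y             ∎
      where open SetoidReasoning setoid

  0≤1 : 0# ≤ 1#
  0≤1 = inj₁ 0<1

  pos⇒≉0 : ∀ {x} → 0# < x → ¬ (x ≈ 0#)
  pos⇒≉0 0<x x≈0 = irrefl (sym x≈0) 0<x

  *-cancelˡ-pos : ∀ {x y} → 0# < x → 0# < x * y → 0# < y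
  *-cancelˡ-pos {x} {y} 0<x 0<xy with compare 0# y
  ... | tri< 0<y _ _ = 0<y
  ... | tri≈ _ 0≈y _ = contradiction (trans (*-congˡ (sym 0≈y)) (zeroʳ x)) (pos⇒≉0 0<xy)
  ... | tri> _ _ y<0 = contradiction (<-respʳ-≈ (zeroʳ x) (*-monoˡ-< 0<x y<0)) (asym 0<xy)

  recip : ∀ {x} → 0# < x → Carrier
  recip {x} 0<x = proj₁ (inverse x (pos⇒≉0 0<x))

  *-recip : ∀ {x} (0<x : 0# < x) → x * recip 0<x ≈ 1#
  *-recip {x} 0<x = proj₂ (inverse x (pos⇒≉0 0<x))

  recip-pos : ∀ {x} (0<x : 0# < x) → 0# < recip 0<x
  recip-pos 0<x = *-cancelˡ-pos 0<x (<-respʳ-≈ (sym (*-recip 0<x)) 0<1)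

  -- Finite sums and minima

  sum-mono-≤ : ∀ {n} {f g : Fin n → Carrier} → (∀ i → f i ≤ g i) → sum f ≤ sum g
  sum-mono-≤ {zero}  f≤g = ≤-reflexive refl
  sum-mono-≤ {suc n} f≤g = +-mono-≤ (f≤g zero) (sum-mono-≤ (f≤g ∘ suc))

  sum-mono-< : ∀ {n} {f g : Fin n → Carrier} → (∀ i → f i ≤ g i) → ∀ i → f i < g i → sum f < sum g
  sum-mono-< {suc n} f≤g zero    lt = +-mono-<-≤ lt (sum-mono-≤ (f≤g ∘ suc))
  sum-mono-< {suc n} f≤g (suc i) lt = +-mono-≤-< (f≤g zero) (sum-mono-< (f≤g ∘ suc) i lt)

  sum-zero : ∀ {n} {f : Fin n → Carrier} → (∀ i → f i ≈ 0#) → sum f ≈ 0#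
  sum-zero {n} f≈0 = trans (sum-cong-≋ f≈0) (sum-replicate-zero n)

  sum-single : ∀ {n} (i : Fin n) {f : Fin n → Carrier} → (∀ j → i ≢ j → f j ≈ 0#) → sum f ≈ f i
  sum-single {suc n} i {f} f≈0 = trans (sum-remove {i = i} f)
    (trans (+-congˡ (sum-zero λ j → f≈0 (punchIn i j) (punchInᵢ≢i i j ∘ ≡.sym))) (+-identityʳ (f i)))

  sum-nonneg : ∀ {n} {f : Fin n → Carrier} → (∀ i → 0# ≤ f i) → 0# ≤ sum f
  sum-nonneg {n} 0≤f = ≤-trans (≤-reflexive (sym (sum-replicate-zero n))) (sum-mono-≤ 0≤f)

  sum-pos : ∀ {n} {f : Fin n → Carrier} → (∀ i → 0# ≤ f i) → ∀ i → 0# < f i → 0# < sum f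
  sum-pos {n} 0≤f i 0<fi = ≤-<-trans (≤-reflexive (sym (sum-replicate-zero n))) (sum-mono-< 0≤f i 0<fi)

  term≤sum : ∀ {n} {f : Fin n → Carrier} → (∀ i → 0# ≤ f i) → ∀ i → f i ≤ sum f
  term≤sum {suc n} {f} 0≤f i = begin
    f i                              ≈⟨ +-identityʳ (f i) ⟨
    f i + 0#                         ≤⟨ +-monoʳ-≤ (f i) (sum-nonneg (0≤f ∘ punchIn i)) ⟩
    f i + sum (f ∘ punchIn i)        ≈⟨ sum-remove {i = i} f ⟨
    sum f                            ∎
    where open ≤-Reasoning

  nonpos-others⇒nonneg : ∀ {n} {f : Fin n → Carrier} i → (∀ j → i ≢ j → f j ≤ 0#) → 0# < sum f → 0# ≤ f i
  nonpos-others⇒nonneg {n} {f} i others≤0 0<sum = ≮⇒≥ λ fi<0 →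
    ≤⇒≯ (≤-trans (sum-mono-≤ (all≤0 fi<0)) (≤-reflexive (sum-replicate-zero n))) 0<sum
    where
    all≤0 : f i < 0# → ∀ j → f j ≤ 0#
    all≤0 fi<0 j with i ≟ j
    ... | yes ≡.refl = inj₁ fi<0
    ... | no i≢j     = others≤0 j i≢j

  argmin : ∀ {n p} {P : Fin n → Set p} → (∀ i → Dec (P i)) → ∃ P → (g : Fin n → Carrier) →
           ∃ λ i → P i × (∀ k → P k → g i ≤ g k)
  argmin {suc n} {P = P} P? (k , Pk) g with any? (P? ∘ suc)
  ... | no ¬P = zero , P0 k Pk , least
    where
    P0 : ∀ k → P k → P zero
    P0 zero    Pk = Pk
    P0 (suc k) Pk = contradiction (k , Pk) ¬P
    least : ∀ k → P k → g zero ≤ g k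
    least zero    _  = ≤-reflexive refl
    least (suc k) Pk = contradiction (k , Pk) ¬P
  ... | yes ∃P with argmin (P? ∘ suc) ∃P (g ∘ suc)
  ... | i , Pi , i-least with P? zero
  ... | no ¬P0 = suc i , Pi , least
    where
    least : ∀ k → P k → g (suc i) ≤ g k
    least zero    P0 = contradiction P0 ¬P0
    least (suc k) Pk = i-least k Pk
  ... | yes P0 with ≤-total (g zero) (g (suc i))
  ... | inj₁ g0≤gi = zero , P0 , least
    where
    least : ∀ k → P k → g zero ≤ g k
    least zero    _  = ≤-reflexive refl
    least (suc k) Pk = ≤-trans g0≤gi (i-least k Pk)
  ... | inj₂ gi≤g0 = suc i , Pi , least
    where
    least : ∀ k → P k → g (suc i) ≤ g k
    least zero    _  = gi≤g0
    least (suc k) Pk = i-least k Pk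

  consᵛ : ∀ {n} {b : Fin (suc n) → ℕ} → Fin (b zero) → Vertex (b ∘ suc) → Vertex b
  consᵛ i B zero    = i
  consᵛ i B (suc j) = B j

  -- One block is chosen at a time: the best completion of every first choice, then the best first
  -- choice. `h-cong` is required because a vertex is only pointwise equal to the one rebuilt from
  -- its head and tail.
  argminᵛ : ∀ {n} {b : Fin n → ℕ} (K : ∀ j → Subset (b j)) → ∃ (_⊆ᵛ K) →
            (h : Vertex b → Carrier) → (∀ {B C} → B ≐ᵛ C → h B ≈ h C) →
            ∃ λ B → B ⊆ᵛ K × (∀ C → C ⊆ᵛ K → h B ≤ h C)
  argminᵛ {zero} K (B , B⊆K) h h-cong = B , B⊆K , λ C _ → ≤-reflexive (h-cong λ ())
  argminᵛ {suc n} {b} K (B , B⊆K) h h-cong = consᵛ i (best i) , ⊆K , least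
    where
    inner : ∀ i → ∃ λ C → C ⊆ᵛ (K ∘ suc) × (∀ C′ → C′ ⊆ᵛ (K ∘ suc) → h (consᵛ i C) ≤ h (consᵛ i C′))
    inner i = argminᵛ (K ∘ suc) (B ∘ suc , B⊆K ∘ suc) (h ∘ consᵛ i)
      λ C≐C′ → h-cong λ { zero → ≡.refl ; (suc j) → C≐C′ j }
    best : Fin (b zero) → Vertex (b ∘ suc)
    best i = proj₁ (inner i)
    outer : ∃ λ i → i ∈ K zero × (∀ k → k ∈ K zero → h (consᵛ i (best i)) ≤ h (consᵛ k (best k)))
    outer = argmin (_∈? K zero) (B zero , B⊆K zero) λ i → h (consᵛ i (best i))
    i : Fin (b zero)
    i = proj₁ outer
    ⊆K : consᵛ i (best i) ⊆ᵛ K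
    ⊆K zero    = proj₁ (proj₂ outer)
    ⊆K (suc j) = proj₁ (proj₂ (inner i)) j
    least : ∀ C → C ⊆ᵛ K → h (consᵛ i (best i)) ≤ h C
    least C C⊆K = begin
      h (consᵛ i (best i))                  ≤⟨ proj₂ (proj₂ outer) (C zero) (C⊆K zero) ⟩
      h (consᵛ (C zero) (best (C zero)))    ≤⟨ proj₂ (proj₂ (inner (C zero))) (C ∘ suc) (C⊆K ∘ suc) ⟩
      h (consᵛ (C zero) (C ∘ suc))          ≈⟨ h-cong (λ { zero → ≡.refl ; (suc j) → ≡.refl }) ⟩
      h C                                   ∎
      where open ≤-Reasoning

  -- Sums over index sets and matrix products

  record IsAdditive {J : Set} (F : (J → Carrier) → Carrier) : Set (c ⊔ ℓ) where
    field
      F-cong : ∀ {f g} → (∀ j → f j ≈ g j) → F f ≈ F g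
      F-zero : F (λ _ → 0#) ≈ 0#
      F-+    : ∀ f g → F (λ j → f j + g j) ≈ F f + F g

  -- Sums over states and sums over actions have to be exchanged with each other in every
  -- combination. With an arbitrary additive functional as the outer sum in `∑-swap`, each index
  -- type proves its exchange law once, and weighted outer sums are covered as well.
  record IsSum (I : Set) {{ix : Index ℝ I}} : Set (lsuc 0ℓ ⊔ c ⊔ ℓ) where
    open Index ix
    field
      ∑-additive : IsAdditive ∑
      *-distribˡ-∑ : ∀ x f → x * ∑ f ≈ ∑ (λ i → x * f i)
      ∑-single   : ∀ i {f} → (∀ j → i ≢ j → f j ≈ 0#) → ∑ f ≈ f i
      ∑-swap     : ∀ {J : Set} {F : (J → Carrier) → Carrier} → IsAdditive F →
                   (f : J → I → Carrier) → F (λ j → ∑ (f j)) ≈ ∑ (λ i → F (λ j → f j i))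
    open IsAdditive ∑-additive public renaming (F-cong to ∑-cong; F-zero to ∑-zero; F-+ to ∑-+)

  instance
    ix-Fin : ∀ {n} → Index ℝ (Fin n)
    ix-Fin = Fin-index ℝ
    ix-N : ∀ {n} {b : Fin n → ℕ} → Index ℝ (N b)
    ix-N = N-index ℝ

  sum-additive : ∀ {n} → IsAdditive (sum {n})
  sum-additive {n} = record
    { F-cong = sum-cong-≋ ; F-zero = sum-replicate-zero n ; F-+ = ∑-distrib-+ }

  sum-swap : ∀ {n} {J : Set} {F : (J → Carrier) → Carrier} → IsAdditive F →
             (f : J → Fin n → Carrier) → F (λ j → sum (f j)) ≈ sum (λ i → F (λ j → f j i))
  sum-swap {zero}  F-add f = IsAdditive.F-zero F-add
  sum-swap {suc n} F-add f = trans (IsAdditive.F-+ F-add _ _) (+-congˡ (sum-swap F-add (λ j → f j ∘ suc)))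

  instance
    sum-Fin : ∀ {n} → IsSum (Fin n)
    sum-Fin = record
      { ∑-additive   = sum-additive
      ; *-distribˡ-∑ = *-distribˡ-sum
      ; ∑-single     = λ i → sum-single i
      ; ∑-swap       = sum-swap
      }

    sum-N : ∀ {n} {b : Fin n → ℕ} → IsSum (N b)
    sum-N {b = b} = record
      { ∑-additive   = record
        { F-cong = λ f≈g → sum-cong-≋ λ j → sum-cong-≋ λ i → f≈g (j , i)
        ; F-zero = sum-zero λ j → sum-zero {b j} λ i → refl
        ; F-+    = λ f g → trans (sum-cong-≋ λ j → ∑-distrib-+ (λ i → f (j , i)) (λ i → g (j , i)))
            (∑-distrib-+ (λ j → sum λ i → f (j , i)) (λ j → sum λ i → g (j , i)))
        }
      ; *-distribˡ-∑ = λ x f → trans (*-distribˡ-sum x (λ j → sum λ i → f (j , i)))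
          (sum-cong-≋ λ j → *-distribˡ-sum x (λ i → f (j , i)))
      ; ∑-single     = λ (j , i) {f} f≈0 → trans
          (sum-single j λ j′ j≢j′ → sum-zero λ i′ → f≈0 (j′ , i′) (j≢j′ ∘ ≡.cong proj₁))
          (sum-single i λ i′ i≢i′ → f≈0 (j , i′) λ { ≡.refl → i≢i′ ≡.refl })
      ; ∑-swap       = λ F-add f → trans (sum-swap F-add (λ k j → sum λ i → f k (j , i)))
          (sum-cong-≋ λ j → sum-swap F-add (λ k i → f k (j , i)))
      }

  module _ {I : Set} {{ix : Index ℝ I}} {{s : IsSum I}} where
    open Index ix
    open IsSum s

    *-additive : ∀ (x : I → Carrier) → IsAdditive {I} (λ f → ∑ (λ i → x i * f i))
    *-additive x = record
      { F-cong = λ f≈g → ∑-cong λ i → *-congˡ (f≈g i)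
      ; F-zero = trans (∑-cong λ i → zeroʳ (x i)) ∑-zero
      ; F-+    = λ f g → trans (∑-cong λ i → distribˡ (x i) (f i) (g i)) (∑-+ _ _)
      }

    *-distribʳ-∑ : ∀ x (f : I → Carrier) → ∑ f * x ≈ ∑ (λ i → f i * x)
    *-distribʳ-∑ x f = trans (*-comm _ x) (trans (*-distribˡ-∑ x f) (∑-cong λ i → *-comm x (f i)))

    diag-same : ∀ (d : I → Carrier) i → diag ℝ d i i ≈ d i
    diag-same d i with i ≟ᴵ i
    ... | yes _  = refl
    ... | no i≢i = contradiction ≡.refl i≢i

    diag-other : ∀ (d : I → Carrier) {i j} → i ≢ j → diag ℝ d i j ≈ 0#
    diag-other d {i} {j} i≢j with i ≟ᴵ j
    ... | yes i≡j = contradiction i≡j i≢j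
    ... | no _    = refl

    ∑-diag : ∀ (d : I → Carrier) i (f : I → Carrier) → ∑ (λ j → diag ℝ d i j * f j) ≈ d i * f i
    ∑-diag d i f = trans
      (∑-single i λ j i≢j → trans (*-congʳ (diag-other d i≢j)) (zeroˡ (f j)))
      (*-congʳ (diag-same d i))

    𝟙-sym : ∀ (i j : I) → 𝟙 ℝ i j ≈ 𝟙 ℝ j i
    𝟙-sym i j with i ≟ᴵ j
    ... | yes ≡.refl = sym (diag-same _ i)
    ... | no i≢j     = sym (diag-other _ (i≢j ∘ ≡.sym))

    ∑-𝟙 : ∀ i (f : I → Carrier) → ∑ (λ j → 𝟙 ℝ i j * f j) ≈ f i
    ∑-𝟙 i f = trans (∑-diag _ i f) (*-identityˡ (f i))

    ∑-diagʳ : ∀ (d : I → Carrier) i (f : I → Carrier) → ∑ (λ j → f j * diag ℝ d j i) ≈ f i * d i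
    ∑-diagʳ d i f = trans
      (∑-single i λ j i≢j → trans (*-congˡ (diag-other d (i≢j ∘ ≡.sym))) (zeroʳ (f j)))
      (*-congˡ (diag-same d i))

    ∑-𝟙ʳ : ∀ i (f : I → Carrier) → ∑ (λ j → f j * 𝟙 ℝ j i) ≈ f i
    ∑-𝟙ʳ i f = trans (∑-diagʳ _ i f) (*-identityʳ (f i))

    ∑-assoc : ∀ {J : Set} {{jx : Index ℝ J}} {{_ : IsSum J}} (x : I → Carrier) (A : I → J → Carrier) (z : J → Carrier) →
              ∑ (λ i → x i * Index.∑ jx (λ j → A i j * z j)) ≈ Index.∑ jx (λ j → ∑ (λ i → x i * A i j) * z j)
    ∑-assoc {J} {{jx}} {{js}} x A z = begin
      ∑ (λ i → x i * J.∑ (λ j → A i j * z j))    ≈⟨ JS.∑-swap (*-additive x) (λ i j → A i j * z j) ⟩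
      J.∑ (λ j → ∑ (λ i → x i * (A i j * z j)))  ≈⟨ JS.∑-cong (λ j → ∑-cong λ i → *-assoc (x i) (A i j) (z j)) ⟨
      J.∑ (λ j → ∑ (λ i → x i * A i j * z j))    ≈⟨ JS.∑-cong (λ j → *-distribʳ-∑ (z j) _) ⟨
      J.∑ (λ j → ∑ (λ i → x i * A i j) * z j)    ∎
      where
      module J = Index jx
      module JS = IsSum js
      open SetoidReasoning setoid

    -- A(VA) = A, so VA = 𝟙 by injectivity.
    inverse-of-injective : (A V : I → I → Carrier) →
      (∀ i j → ∑ (λ k → A i k * V k j) ≈ 𝟙 ℝ i j) →
      (∀ (v w : I → Carrier) → (∀ i → ∑ (λ k → A i k * v k) ≈ ∑ (λ k → A i k * w k)) → ∀ i → v i ≈ w i) →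
      Inverse ℝ A
    inverse-of-injective A V AV≈𝟙 inj = record
      { mat  = V
      ; invˡ = λ i j → inj (λ k → ∑ (λ l → V k l * A l j)) (λ k → 𝟙 ℝ k j) (λ k → A[VA]≈A k j) i
      ; invʳ = AV≈𝟙
      }
      where
      open SetoidReasoning setoid
      A[VA]≈A : ∀ k j → ∑ (λ l → A k l * ∑ (λ m → V l m * A m j)) ≈ ∑ (λ l → A k l * 𝟙 ℝ l j)
      A[VA]≈A k j = begin
        ∑ (λ l → A k l * ∑ (λ m → V l m * A m j))   ≈⟨ ∑-assoc (A k) V (λ m → A m j) ⟩
        ∑ (λ m → ∑ (λ l → A k l * V l m) * A m j)   ≈⟨ ∑-cong (λ m → *-congʳ (AV≈𝟙 k m)) ⟩
        ∑ (λ m → 𝟙 ℝ k m * A m j)                   ≈⟨ ∑-𝟙 k (λ m → A m j) ⟩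
        A k j                                       ≈⟨ ∑-𝟙ʳ j (A k) ⟨
        ∑ (λ l → A k l * 𝟙 ℝ l j)                   ∎

  -- M-matrices

  dot : ∀ {n} → (Fin n → Carrier) → (Fin n → Carrier) → Carrier
  dot x y = sum λ i → x i * y i

  dot-congʳ : ∀ {n} (x : Fin n → Carrier) {v w} → (∀ i → v i ≈ w i) → dot x v ≈ dot x w
  dot-congʳ x v≈w = sum-cong-≋ λ i → *-congˡ (v≈w i)

  dot-congˡ : ∀ {n} {x y : Fin n → Carrier} v → (∀ i → x i ≈ y i) → dot x v ≈ dot y v
  dot-congˡ v x≈y = sum-cong-≋ λ i → *-congʳ (x≈y i)

  dot-comm : ∀ {n} (x y : Fin n → Carrier) → dot x y ≈ dot y x
  dot-comm x y = sum-cong-≋ λ i → *-comm (x i) (y i)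

  𝟙-nonneg : ∀ {n} (i j : Fin n) → 0# ≤ 𝟙 ℝ i j
  𝟙-nonneg i j with i ≟ j
  ... | yes _ = 0≤1
  ... | no  _ = ≤-reflexive refl

  dot-axpy : ∀ {n} (x v : Fin n → Carrier) s w → dot x (λ i → v i + s * w i) ≈ dot x v + s * dot x w
  dot-axpy x v s w = begin
    sum (λ i → x i * (v i + s * w i))                    ≈⟨ sum-cong-≋ (λ i → trans (distribˡ (x i) (v i) (s * w i)) (+-congˡ (swap (x i) s (w i)))) ⟩
    sum (λ i → x i * v i + s * (x i * w i))              ≈⟨ ∑-distrib-+ (λ i → x i * v i) (λ i → s * (x i * w i)) ⟩
    dot x v + sum (λ i → s * (x i * w i))                ≈⟨ +-congˡ (*-distribˡ-sum s (λ i → x i * w i)) ⟨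
    dot x v + s * dot x w                                ∎
    where
    open SetoidReasoning setoid
    swap : ∀ a b d → a * (b * d) ≈ b * (a * d)
    swap a b d = trans (sym (*-assoc a b d)) (trans (*-congʳ (*-comm a b)) (*-assoc b a d))

  dot-neg : ∀ {n} (x v : Fin n → Carrier) → dot x (λ i → - v i) ≈ - dot x v
  dot-neg x v = begin
    sum (λ i → x i * - v i)          ≈⟨ sum-cong-≋ (λ i → trans (sym (-‿distribʳ-* (x i) (v i))) (sym (-1*x≈-x _))) ⟩
    sum (λ i → - 1# * (x i * v i))   ≈⟨ *-distribˡ-sum (- 1#) (λ i → x i * v i) ⟨
    - 1# * dot x v                   ≈⟨ -1*x≈-x _ ⟩
    - dot x v                        ∎
    where open SetoidReasoning setoid

  -- A nonsingular M-matrix, presented by a certificate of semipositivity. Both constructions supply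
  -- such a vector: the all-ones vector for a game, `p` for a grid LP.
  record IsMMatrix {n} (W : Fin n → Fin n → Carrier) (x : Fin n → Carrier) : Set ℓ where
    field
      offdiag : ∀ i j → i ≢ j → W i j ≤ 0#
      x-pos   : ∀ i → 0# < x i
      Wx-pos  : ∀ i → 0# < dot (W i) x

  module _ {n} {W : Fin n → Fin n → Carrier} {x : Fin n → Carrier} (isM : IsMMatrix W x) where
    open IsMMatrix isM

    -- At an index i minimising v i / x i, a negative ratio t would give
    -- (Wv) i ≤ t (Wx) i < 0.
    monotone : ∀ {v} → (∀ i → 0# ≤ dot (W i) v) → ∀ i → 0# ≤ v i
    monotone {v} 0≤Wv k = begin
      0#              ≤⟨ *-nonneg 0≤t (inj₁ (x-pos k)) ⟩
      t * x k         ≤⟨ *-monoʳ-≤ (inj₁ (x-pos k)) (ratio-least k _) ⟩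
      ratio k * x k   ≈⟨ ratio*x k ⟩
      v k             ∎
      where
      open ≤-Reasoning
      ratio : Fin n → Carrier
      ratio i = v i * recip (x-pos i)
      ratio*x : ∀ i → ratio i * x i ≈ v i
      ratio*x i = trans (*-assoc (v i) _ (x i))
        (trans (*-congˡ (trans (*-comm _ (x i)) (*-recip (x-pos i)))) (*-identityʳ (v i)))
      least : ∃ λ i → Unit.⊤ × (∀ k → Unit.⊤ → ratio i ≤ ratio k)
      least = argmin (λ _ → yes _) (k , _) ratio
      i : Fin n
      i = proj₁ least
      t : Carrier
      t = ratio i
      ratio-least : ∀ k → Unit.⊤ → t ≤ ratio k
      ratio-least = proj₂ (proj₂ least)
      term : ∀ j → W i j * v j ≤ t * (W i j * x j)
      term j = ≤-trans term′ (≤-reflexive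
        (trans (sym (*-assoc (W i j) t (x j))) (trans (*-congʳ (*-comm (W i j) t)) (*-assoc t (W i j) (x j)))))
        where
        term′ : W i j * v j ≤ W i j * (t * x j)
        term′ with i ≟ j
        ... | yes ≡.refl = ≤-reflexive (*-congˡ (sym (ratio*x i)))
        ... | no i≢j     = *-antimonoˡ-≤ (offdiag i j i≢j)
          (≤-trans (*-monoʳ-≤ (inj₁ (x-pos j)) (ratio-least j _)) (≤-reflexive (ratio*x j)))
      Wv≤tWx : dot (W i) v ≤ t * dot (W i) x
      Wv≤tWx = ≤-trans (sum-mono-≤ term) (≤-reflexive (sym (*-distribˡ-sum t (λ j → W i j * x j))))
      0≤t : 0# ≤ t
      0≤t = ≮⇒≥ λ t<0 → ≤⇒≯ (≤-trans (0≤Wv i) Wv≤tWx)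
        (<-respˡ-≈ (*-comm _ t) (<-respʳ-≈ (zeroʳ _) (*-monoˡ-< (Wx-pos i) t<0)))

    -- W annihilates both v - w and w - v, so by monotonicity both are nonnegative.
    injective : ∀ v w → (∀ i → dot (W i) v ≈ dot (W i) w) → ∀ i → v i ≈ w i
    injective v w Wv≈Ww i = antisym (w≤v w v (λ i → sym (Wv≈Ww i)) i) (w≤v v w Wv≈Ww i)
      where
      w≤v : ∀ v w → (∀ i → dot (W i) v ≈ dot (W i) w) → ∀ i → w i ≤ v i
      w≤v v w Wv≈Ww i = 0≤y-x⇒x≤y (≤-trans
        (monotone {λ i → v i + - 1# * w i} (λ i → ≤-reflexive (sym (begin
          dot (W i) (λ i → v i + - 1# * w i)     ≈⟨ dot-axpy (W i) v (- 1#) w ⟩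
          dot (W i) v + - 1# * dot (W i) w       ≈⟨ +-cong (Wv≈Ww i) (-1*x≈-x _) ⟩
          dot (W i) w - dot (W i) w              ≈⟨ -‿inverseʳ _ ⟩
          0#                                     ∎))) i)
        (≤-reflexive (+-congˡ (-1*x≈-x (w i)))))
        where open SetoidReasoning setoid

  -- If v i were zero, the diagonal term of (Wv) i would vanish and all others would be nonpositive.
  -- The matrix enters through its sign pattern alone, so the lemma serves for transposes of
  -- M-matrices too.
  strictly-monotone : ∀ {n} {W : Fin n → Fin n → Carrier} → (∀ i j → i ≢ j → W i j ≤ 0#) →
                      ∀ {v} → (∀ i → 0# ≤ v i) → ∀ i → 0# < dot (W i) v → 0# < v i
  strictly-monotone {n} {W} offdiag {v} 0≤v i 0<Wv with compare 0# (v i)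
  ... | tri< 0<vi _ _ = 0<vi
  ... | tri> _ _ vi<0 = contradiction vi<0 (≤⇒≯ (0≤v i))
  ... | tri≈ _ 0≈vi _ = contradiction 0<Wv (≤⇒≯ (≤-trans (sum-mono-≤ term) (≤-reflexive (sum-replicate-zero n))))
    where
    term : ∀ j → W i j * v j ≤ 0#
    term j with i ≟ j
    ... | yes ≡.refl = ≤-reflexive (trans (*-congˡ (sym 0≈vi)) (zeroʳ _))
    ... | no i≢j     = *-nonpos-nonneg (offdiag i j i≢j) (0≤v j)

  Solvable : ∀ {n} → (Fin n → Fin n → Carrier) → Set (c ⊔ ℓ)
  Solvable {n} W = ∀ (r : Fin n → Carrier) → ∃ λ v → ∀ i → dot (W i) v ≈ r i

  -- Replacing row j of an M-matrix by the unit vector gives an M-matrix W⁰; if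
  -- W⁰v₁ = e_j then the pivot (Wv₁) j is positive by monotonicity of W, so
  -- multiples of v₁ correct the j-th entry.
  module _ {n} {W : Fin n → Fin n → Carrier} {x : Fin n → Carrier} (isM : IsMMatrix W x) (j : Fin n) where
    open IsMMatrix isM

    unitRow : Fin n → Fin n → Carrier
    unitRow = updateAt W j (λ _ → 𝟙 ℝ j)

    unitRow-j : ∀ l → unitRow j l ≡ 𝟙 ℝ j l
    unitRow-j l = ≡.cong (λ row → row l) (updateAt-updates j W)

    unitRow-i : ∀ i → i ≢ j → ∀ l → unitRow i l ≡ W i l
    unitRow-i i i≢j l = ≡.cong (λ row → row l) (updateAt-minimal i j W i≢j)

    unitRow-isM : IsMMatrix unitRow x
    unitRow-isM = record { offdiag = offdiag′ ; x-pos = x-pos ; Wx-pos = Wx-pos′ }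
      where
      offdiag′ : ∀ i l → i ≢ l → unitRow i l ≤ 0#
      offdiag′ i l i≢l with i ≟ j
      ... | yes ≡.refl = ≤-reflexive (trans (reflexive (unitRow-j l)) (diag-other _ i≢l))
      ... | no i≢j     = ≤-trans (≤-reflexive (reflexive (unitRow-i i i≢j l))) (offdiag i l i≢l)
      Wx-pos′ : ∀ i → 0# < dot (unitRow i) x
      Wx-pos′ i with i ≟ j
      ... | yes ≡.refl = <-respʳ-≈ (sym (trans (dot-congˡ x (reflexive ∘ unitRow-j)) (∑-𝟙 j x))) (x-pos j)
      ... | no i≢j     = <-respʳ-≈ (sym (dot-congˡ x (reflexive ∘ unitRow-i i i≢j))) (Wx-pos i)

    unitRow-solvable : Solvable unitRow → Solvable W
    unitRow-solvable solve r = v , Wv≈r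
      where
      v₀ v₁ v : Fin n → Carrier
      v₀ = proj₁ (solve r)
      v₁ = proj₁ (solve (𝟙 ℝ j))
      W-i : ∀ i → i ≢ j → ∀ u → dot (W i) u ≈ dot (unitRow i) u
      W-i i i≢j u = dot-congˡ u (sym ∘ reflexive ∘ unitRow-i i i≢j)
      Wv₁≈0 : ∀ i → i ≢ j → dot (W i) v₁ ≈ 0#
      Wv₁≈0 i i≢j = trans (W-i i i≢j v₁) (trans (proj₂ (solve (𝟙 ℝ j)) i) (diag-other _ (i≢j ∘ ≡.sym)))
      v₁j≈1 : v₁ j ≈ 1#
      v₁j≈1 = begin
        v₁ j                       ≈⟨ ∑-𝟙 j v₁ ⟨
        dot (𝟙 ℝ j) v₁             ≈⟨ dot-congˡ v₁ (reflexive ∘ unitRow-j) ⟨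
        dot (unitRow j) v₁         ≈⟨ proj₂ (solve (𝟙 ℝ j)) j ⟩
        𝟙 ℝ j j                    ≈⟨ diag-same _ j ⟩
        1#                         ∎
        where open SetoidReasoning setoid
      -- Were the pivot nonpositive, W would map - v₁ to a nonnegative vector, and monotonicity
      -- would give - v₁ ≥ 0 although v₁ j = 1.
      pivot-pos : 0# < dot (W j) v₁
      pivot-pos = ≰⇒> λ π≤0 → ≤⇒≯ (-v₁≥0 π≤0 j) (<-respˡ-≈ (-‿cong (sym v₁j≈1)) (0<x⇒-x<0 0<1))
        where
        -v₁≥0 : dot (W j) v₁ ≤ 0# → ∀ i → 0# ≤ - v₁ i
        -v₁≥0 π≤0 = monotone isM λ i → ≤-trans (0≤ i) (≤-reflexive (sym (dot-neg (W i) v₁)))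
          where
          0≤ : ∀ i → 0# ≤ - dot (W i) v₁
          0≤ i with i ≟ j
          ... | yes ≡.refl = x≤0⇒0≤-x π≤0
          ... | no i≢j     = x≤0⇒0≤-x (≤-reflexive (Wv₁≈0 i i≢j))
      s : Carrier
      s = (r j - dot (W j) v₀) * recip pivot-pos
      v i = v₀ i + s * v₁ i
      Wv≈r : ∀ i → dot (W i) v ≈ r i
      Wv≈r i with i ≟ j
      ... | yes ≡.refl = begin
        dot (W i) v                                ≈⟨ dot-axpy (W i) v₀ s v₁ ⟩
        dot (W i) v₀ + s * dot (W i) v₁            ≈⟨ +-congˡ (trans (*-assoc _ _ _) (*-congˡ (trans (*-comm _ _) (*-recip pivot-pos)))) ⟩
        dot (W i) v₀ + (r i - dot (W i) v₀) * 1#   ≈⟨ +-congˡ (*-identityʳ _) ⟩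
        dot (W i) v₀ + (r i - dot (W i) v₀)        ≈⟨ +-comm _ _ ⟩
        (r i - dot (W i) v₀) + dot (W i) v₀        ≈⟨ [x-y]+y≈x _ _ ⟩
        r i                                        ∎
        where open SetoidReasoning setoid
      ... | no i≢j = begin
        dot (W i) v                                ≈⟨ dot-axpy (W i) v₀ s v₁ ⟩
        dot (W i) v₀ + s * dot (W i) v₁            ≈⟨ +-cong (trans (W-i i i≢j v₀) (proj₂ (solve r) i)) (trans (*-congˡ (Wv₁≈0 i i≢j)) (zeroʳ s)) ⟩
        r i + 0#                                   ≈⟨ +-identityʳ _ ⟩
        r i                                        ∎
        where open SetoidReasoning setoid

  -- Elimination as an induction on the number k of leading rows that may differ from unit rows.
  -- Making row k a unit row keeps the M-matrix property with the same certificate, and the identity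
  -- remains at the end.
  solvable-from : ∀ {n} k {W : Fin n → Fin n → Carrier} {x} → IsMMatrix W x →
                  (∀ i → k ℕ.≤ toℕ i → ∀ l → W i l ≈ 𝟙 ℝ i l) → Solvable W
  solvable-from zero isM W≈𝟙 r = r , λ i → trans (dot-congˡ r (W≈𝟙 i z≤n)) (∑-𝟙 i r)
  solvable-from {n} (suc k) {W} isM W≈𝟙 with k ℕ.<? n
  ... | no  k≮n = solvable-from k isM λ i k≤i → contradiction (ℕ.≤-<-trans k≤i (toℕ<n i)) k≮n
  ... | yes k<n = unitRow-solvable isM j (solvable-from k (unitRow-isM isM j) W⁰≈𝟙)
    where
    j : Fin n
    j = fromℕ< k<n
    W⁰≈𝟙 : ∀ i → k ℕ.≤ toℕ i → ∀ l → unitRow isM j i l ≈ 𝟙 ℝ i l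
    W⁰≈𝟙 i k≤i l with i ≟ j
    ... | yes ≡.refl = reflexive (unitRow-j isM j l)
    ... | no i≢j     = trans (reflexive (unitRow-i isM j i i≢j l))
      (W≈𝟙 i (ℕ.≤∧≢⇒< k≤i λ k≡i → i≢j (toℕ-injective (≡.trans (≡.sym k≡i) (≡.sym (toℕ-fromℕ< k<n))))) l)

  M-matrix-solvable : ∀ {n} {W : Fin n → Fin n → Carrier} {x} → IsMMatrix W x → Solvable W
  M-matrix-solvable {n} isM = solvable-from n isM λ i n≤i → contradiction (toℕ<n i) (ℕ.≤⇒≯ n≤i)

  solvable-inverse : ∀ {n} {W : Fin n → Fin n → Carrier} → Solvable W →
    (∀ v w → (∀ i → dot (W i) v ≈ dot (W i) w) → ∀ i → v i ≈ w i) → Inverse ℝ W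
  solvable-inverse {W = W} solve inj = inverse-of-injective W
    (λ k j → proj₁ (solve (𝟙 ℝ j)) k)
    (λ i j → trans (proj₂ (solve (𝟙 ℝ j)) i) (𝟙-sym j i))
    inj

  M-matrix-inverse : ∀ {n} {W : Fin n → Fin n → Carrier} {x} → IsMMatrix W x → Inverse ℝ W
  M-matrix-inverse isM = solvable-inverse (M-matrix-solvable isM) (injective isM)

  transpose-inverse : ∀ {n} {W : Fin n → Fin n → Carrier} → Inverse ℝ W → Inverse ℝ (_ᵀ ℝ W)
  transpose-inverse {W = W} V = record
    { mat  = λ i j → mat j i
    ; invˡ = λ i j → trans (dot-comm (λ k → mat k i) (W j)) (trans (invʳ j i) (𝟙-sym j i))
    ; invʳ = λ i j → trans (dot-comm (λ k → W k i) (mat j)) (trans (invˡ j i) (𝟙-sym j i))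
    }
    where open Inverse V

  -- W maps each column of its inverse to a unit vector, which is nonnegative.
  M-matrix-inverse-nonneg : ∀ {n} {W : Fin n → Fin n → Carrier} {x} → IsMMatrix W x →
                            (V : Inverse ℝ W) → ∀ i j → 0# ≤ Inverse.mat V i j
  M-matrix-inverse-nonneg {W = W} isM V i j = monotone isM {λ k → mat k j} 0≤Wmat i
    where
    open Inverse V
    0≤Wmat : ∀ k → 0# ≤ dot (W k) (λ l → mat l j)
    0≤Wmat k = ≤-trans (𝟙-nonneg k j) (≤-reflexive (sym (invʳ k j)))

  -- Optimal vertices of a grid LP

  module _ {n} {b : Fin n → ℕ} where

    update-same : ∀ (B : Vertex b) j k → (B [ j ≔ k ]) j ≡ k
    update-same B j k with j ≟ j
    ... | yes ≡.refl = ≡.refl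
    ... | no j≢j     = contradiction ≡.refl j≢j

    update-other : ∀ (B : Vertex b) j k {l} → j ≢ l → (B [ j ≔ k ]) l ≡ B l
    update-other B j k {l} j≢l with j ≟ l
    ... | yes j≡l = contradiction j≡l j≢l
    ... | no _    = ≡.refl

    update-⊆ : ∀ {K : ∀ j → Subset (b j)} {B : Vertex b} {j k} → B ⊆ᵛ K → k ∈ K j → (B [ j ≔ k ]) ⊆ᵛ K
    update-⊆ {K} {B} {j} {k} B⊆K k∈K l with j ≟ l
    ... | yes ≡.refl = k∈K
    ... | no _       = B⊆K l

  module _ {n} {b : Fin n → ℕ} where

    neighbour-∼ : ∀ (B : Vertex (b +𝟏)) j k → B ∼[ j ] neighbour B (j , k)
    neighbour-∼ B j k =
      (λ eq → punchInᵢ≢i (B j) k (≡.sym (≡.trans eq (update-same B j (punchIn (B j) k))))) ,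
      (λ l l≢j → ≡.sym (update-other B j (punchIn (B j) k) (l≢j ∘ ≡.sym)))

    ∼⇒neighbour : ∀ {B C : Vertex (b +𝟏)} {j} ((Bj≢Cj , _) : B ∼[ j ] C) →
                  neighbour B (j , punchOut Bj≢Cj) ≐ᵛ C
    ∼⇒neighbour {B} {C} {j} (Bj≢Cj , same) l with j ≟ l
    ... | yes ≡.refl = punchIn-punchOut Bj≢Cj
    ... | no j≢l     = same l (j≢l ∘ ≡.sym)

  -- The program in standard form: minimise costᵀx subject to Rᵀx = p, x ≥ 0. Here `x B` is the
  -- basic solution at B, positive for every B, and a vector with `IsDual cost B` is the dual vector
  -- of that basis, so that pᵀy is the cost of B. Optimality of B is dual feasibility Ry ≤ cost.
  module LinearProgram {n} {a : Fin n → ℕ} (R : N a → Fin n → Carrier) (p : Fin n → Carrier)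
    (x : Vertex a → Fin n → Carrier) (x-pos : ∀ B j → 0# < x B j)
    (x-feasible : ∀ B i → sum (λ j → x B j * R (j , B j) i) ≈ p i) where

    IsDual : (N a → Carrier) → Vertex a → (Fin n → Carrier) → Set ℓ
    IsDual cost B y = ∀ j → dot (R (j , B j)) y ≈ cost (j , B j)

    -- The identity behind all comparisons below: since B is arbitrary, objective values can be
    -- compared row by row at whichever vertex is convenient, with positive weights.
    objective : ∀ B y → dot p y ≈ sum (λ j → x B j * dot (R (j , B j)) y)
    objective B y = trans (dot-congˡ y (sym ∘ x-feasible B)) (sym (∑-assoc (x B) (λ j → R (j , B j)) y))

    module _ {cost : N a → Carrier} {C : Vertex a} {y z : Fin n → Carrier} (dual : IsDual cost C z) where

      objective-≤ : (∀ j → dot (R (j , C j)) y ≤ cost (j , C j)) → dot p y ≤ dot p z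
      objective-≤ le = begin
        dot p y                                       ≈⟨ objective C y ⟩
        sum (λ j → x C j * dot (R (j , C j)) y)       ≤⟨ sum-mono-≤ (λ j → *-monoˡ-≤ (inj₁ (x-pos C j)) (≤-trans (le j) (≤-reflexive (sym (dual j))))) ⟩
        sum (λ j → x C j * dot (R (j , C j)) z)       ≈⟨ objective C z ⟨
        dot p z                                       ∎
        where open ≤-Reasoning

      objective-< : (∀ j → dot (R (j , C j)) y ≤ cost (j , C j)) →
                    ∀ j → dot (R (j , C j)) y < cost (j , C j) → dot p y < dot p z
      objective-< le j lt = begin-strict
        dot p y                                       ≈⟨ objective C y ⟩
        sum (λ j → x C j * dot (R (j , C j)) y)       <⟨ sum-mono-< (λ j → *-monoˡ-≤ (inj₁ (x-pos C j)) (≤-trans (le j) (≤-reflexive (sym (dual j)))))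
                                                           j (*-monoˡ-< (x-pos C j) (<-respʳ-≈ (sym (dual j)) lt)) ⟩
        sum (λ j → x C j * dot (R (j , C j)) z)       ≈⟨ objective C z ⟨
        dot p z                                       ∎
        where open ≤-Reasoning

    module _ (cost : N a → Carrier) (y : Vertex a → Fin n → Carrier) (dual : ∀ B → IsDual cost B (y B))
             (K : ∀ j → Subset (a j)) where

      -- A vertex of least objective value admits no improving exchange.
      optimum : ∃ (_⊆ᵛ K) → ∃ λ B → B ⊆ᵛ K × (∀ j i → i ∈ K j → dot (R (j , i)) (y B) ≤ cost (j , i))
      optimum nonempty = B , B⊆K , optimal
        where
        -- Pointwise equal vertices may be given different dual vectors, but these satisfy the same
        -- equations on the basis, which determine the objective value.
        value-cong : ∀ {B C} → B ≐ᵛ C → dot p (y B) ≈ dot p (y C)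
        value-cong B≐C = antisym (≤′ B≐C) (≤′ (≡.sym ∘ B≐C))
          where
          ≤′ : ∀ {B C} → B ≐ᵛ C → dot p (y B) ≤ dot p (y C)
          ≤′ {B} {C} B≐C = objective-≤ {cost} (dual C) λ j → ≤-reflexive
            (≡.subst (λ i → dot (R (j , i)) (y B) ≈ cost (j , i)) (B≐C j) (dual B j))
        best : ∃ λ B → B ⊆ᵛ K × (∀ C → C ⊆ᵛ K → dot p (y B) ≤ dot p (y C))
        best = argminᵛ K nonempty (λ B → dot p (y B)) value-cong
        B : Vertex a
        B = proj₁ best
        B⊆K : B ⊆ᵛ K
        B⊆K = proj₁ (proj₂ best)
        -- Suppose row (j , i) is violated and C takes it in. With the weights `x C`, the vector
        -- `y B` meets the cost on the rows kept from B and exceeds it on the new one, so C would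
        -- have a smaller objective value than B.
        optimal : ∀ j i → i ∈ K j → dot (R (j , i)) (y B) ≤ cost (j , i)
        optimal j i i∈K = ≮⇒≥ λ lt → ≤⇒≯ (proj₂ (proj₂ best) C (update-⊆ B⊆K i∈K)) (improves lt)
          where
          C : Vertex a
          C = B [ j ≔ i ]
          module _ (lt : cost (j , i) < dot (R (j , i)) (y B)) where
            lt-C : cost (j , C j) < dot (R (j , C j)) (y B)
            lt-C = ≡.subst (λ i → cost (j , i) < dot (R (j , i)) (y B)) (≡.sym (update-same B j i)) lt
            le-C : ∀ l → cost (l , C l) ≤ dot (R (l , C l)) (y B)
            le-C l with j ≟ l
            ... | yes ≡.refl = inj₁ lt
            ... | no _       = ≤-reflexive (sym (dual B l))
            improves : dot p (y C) < dot p (y B)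
            improves = begin-strict
              dot p (y C)                                       ≈⟨ objective C (y C) ⟩
              sum (λ l → x C l * dot (R (l , C l)) (y C))       ≈⟨ sum-cong-≋ (λ l → *-congˡ (dual C l)) ⟩
              sum (λ l → x C l * cost (l , C l))                <⟨ sum-mono-< (λ l → *-monoˡ-≤ (inj₁ (x-pos C l)) (le-C l)) j (*-monoˡ-< (x-pos C j) lt-C) ⟩
              sum (λ l → x C l * dot (R (l , C l)) (y B))       ≈⟨ objective C (y B) ⟨
              dot p (y B)                                       ∎
              where open ≤-Reasoning

      IsStrictOptimum : Vertex a → Set ℓ
      IsStrictOptimum B = ∀ j i → i ∈ K j → B j ≢ i → dot (R (j , i)) (y B) < cost (j , i)

      -- Comparison with the weights `x C` puts a strict optimum strictly below every different
      -- vertex C of the subgrid. Two different strict optima would each lie below the other.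
      strictOptimum-unique : ∀ {B C} → B ⊆ᵛ K → C ⊆ᵛ K → IsStrictOptimum B → IsStrictOptimum C → B ≐ᵛ C
      strictOptimum-unique {B} {C} B⊆K C⊆K B-opt C-opt j with B j ≟ C j
      ... | yes Bj≡Cj = Bj≡Cj
      ... | no Bj≢Cj  = contradiction (below B-opt C⊆K Bj≢Cj) (asym (below C-opt B⊆K (Bj≢Cj ∘ ≡.sym)))
        where
        below : ∀ {B C} → IsStrictOptimum B → C ⊆ᵛ K → ∀ {j} → B j ≢ C j → dot p (y B) < dot p (y C)
        below {B} {C} B-opt C⊆K {j} Bj≢Cj = objective-< {cost} (dual C) le j (B-opt j (C j) (C⊆K j) Bj≢Cj)
          where
          le : ∀ j → dot (R (j , C j)) (y B) ≤ cost (j , C j)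
          le j with B j ≟ C j
          ... | yes Bj≡Cj = ≤-reflexive (≡.subst (λ i → dot (R (j , i)) (y B) ≈ cost (j , i)) Bj≡Cj (dual B j))
          ... | no Bj≢Cj  = inj₁ (B-opt j (C j) (C⊆K j) Bj≢Cj)

  -- The common shape of both definitions of an orientation: f is the reduced cost of a grid LP or
  -- the value of a game.
  record IsInduced {n} {b : Fin n → ℕ} (φ : Orientation (b +𝟏)) (f : Vertex (b +𝟏) → N b → Carrier) : Set ℓ where
    open Orientation φ
    field
      nonzero : ∀ B k → ¬ (f B k ≈ 0#)
      induced : ∀ B k → (B ⟶ neighbour B k) ⇔ (f B k < 0#)

  module _ {n} {b : Fin n → ℕ} (R : N (b +𝟏) → Fin n → Carrier) (p : Fin n → Carrier)
    (x : Vertex (b +𝟏) → Fin n → Carrier) (x-pos : ∀ B j → 0# < x B j)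
    (x-feasible : ∀ B i → sum (λ j → x B j * R (j , B j) i) ≈ p i) where
    open LinearProgram R p x x-pos x-feasible

    -- The sinks of a subgrid are the optimal vertices of the program restricted to the rows of that
    -- subgrid, and nondegeneracy makes them strictly optimal. Existence is the minimum over
    -- vertices, uniqueness the comparison of strict optima.
    reducedCost-isUSO : (φ : Orientation (b +𝟏)) (f : Vertex (b +𝟏) → N b → Carrier) → IsInduced φ f →
      (cost : N (b +𝟏) → Carrier) (y : Vertex (b +𝟏) → Fin n → Carrier) → (∀ B → IsDual cost B (y B)) →
      (∀ B k → f B k + dot (R (nonbasic B k)) (y B) ≈ cost (nonbasic B k)) → IsUSO φ
    reducedCost-isUSO φ f φ-f cost y dual f≈rc K nonempty = B , (B⊆K , no-exit) , unique
      where
      open Orientation φ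
      open IsInduced φ-f
      opt : ∃ λ B → B ⊆ᵛ K × (∀ j i → i ∈ K j → dot (R (j , i)) (y B) ≤ cost (j , i))
      opt = optimum cost y dual K nonempty
      B : Vertex (b +𝟏)
      B = proj₁ opt
      B⊆K : B ⊆ᵛ K
      B⊆K = proj₁ (proj₂ opt)
      no-exit : ∀ C → C ⊆ᵛ K → ¬ (B ⟶ C)
      no-exit C C⊆K B⟶C with ⟶-edge B⟶C
      ... | j , e@(Bj≢Cj , _) = ≤⇒≯ (proj₂ (proj₂ opt) j (C j) (C⊆K j)) cost<
        where
        k : N b
        k = j , punchOut Bj≢Cj
        f<0 : f B k < 0#
        f<0 = Equivalence.to (induced B k) (⟶-resp (λ _ → ≡.refl) (≡.sym ∘ ∼⇒neighbour e) B⟶C)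
        cost<′ : cost (nonbasic B k) < dot (R (nonbasic B k)) (y B)
        cost<′ = <-respˡ-≈ (f≈rc B k) (<-respʳ-≈ (+-identityˡ _) (+-monoˡ-< _ f<0))
        cost< : cost (j , C j) < dot (R (j , C j)) (y B)
        cost< = ≡.subst (λ i → cost (j , i) < dot (R (j , i)) (y B)) (punchIn-punchOut Bj≢Cj) cost<′
      sink⇒strict : ∀ {C} → IsSink φ K C → IsStrictOptimum cost y dual K C
      sink⇒strict {C} (C⊆K , no-exit) j i i∈K Cj≢i =
        ≡.subst (λ i → dot (R (j , i)) (y C) < cost (j , i)) (punchIn-punchOut Cj≢i)
          (<-respʳ-≈ (f≈rc C k) (<-respˡ-≈ (+-identityˡ _) (+-monoˡ-< _ 0<f)))
        where
        k : N b
        k = j , punchOut Cj≢i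
        0<f : 0# < f C k
        0<f = ≰⇒> λ { (inj₁ f<0) → no-exit (neighbour C k)
                        (update-⊆ C⊆K (≡.subst (_∈ K j) (≡.sym (punchIn-punchOut Cj≢i)) i∈K))
                        (Equivalence.from (induced C k) f<0)
                    ; (inj₂ f≈0) → nonzero C k f≈0 }
      unique : ∀ C → IsSink φ K C → B ≐ᵛ C
      unique C C-sink = strictOptimum-unique cost y dual K B⊆K (proj₁ C-sink)
        (sink⇒strict (B⊆K , no-exit)) (sink⇒strict C-sink)

  -- The generalised linear complementarity problem

  top-elim : ∀ {m p} (P : Fin (suc m) → Set p) → P (fromℕ m) → (∀ i → P (inject₁ i)) → ∀ i → P i
  top-elim P top lower i with view i
  ... | ‵fromℕ     = top
  ... | ‵inject₁ k = lower k

  module _ {n} {b : Fin n → ℕ} where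

    -- The reference vertex: the actions C of a game, the slack columns of a grid LP.
    top : Vertex (b +𝟏)
    top j = fromℕ (b j)

    last : Fin n → N (b +𝟏)
    last = basic top

    inject : N b → N (b +𝟏)
    inject (j , i) = j , inject₁ i

    [∣]-last : ∀ (u : N b → Carrier) v j → [_∣_]ᵛ ℝ u v (last j) ≡ v j
    [∣]-last u v j rewrite view-fromℕ (b j) = ≡.refl

    [∣]-inject : ∀ (u : N b → Carrier) v k → [_∣_]ᵛ ℝ u v (inject k) ≡ u k
    [∣]-inject u v (j , i) rewrite view-inject₁ i = ≡.refl

    open Index (ix-N {n} {b}) using () renaming (∑ to ∑ᴺ)
    open Index (ix-N {n} {b +𝟏}) using () renaming (∑ to ∑ᴺ⁺)

    ∑-basic : ∀ (B : Vertex (b +𝟏)) (f : N (b +𝟏) → Carrier) →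
              ∑ᴺ⁺ f ≈ sum (f ∘ basic B) + ∑ᴺ (f ∘ nonbasic B)
    ∑-basic B f = trans
      (sum-cong-≋ λ j → sum-remove {i = B j} (λ i → f (j , i)))
      (∑-distrib-+ (f ∘ basic B) (λ j → sum λ i → f (nonbasic B (j , i))))

    ∑-last : ∀ (f : N (b +𝟏) → Carrier) → ∑ᴺ⁺ f ≈ ∑ᴺ (f ∘ inject) + sum (f ∘ last)
    ∑-last f = trans
      (sum-cong-≋ λ j → sum-init-last (λ i → f (j , i)))
      (∑-distrib-+ (λ j → sum λ i → f (inject (j , i))) (f ∘ last))

    rows : (N b → Fin n → Carrier) → N (b +𝟏) → Fin n → Carrier
    rows M x i = [_∣_] ℝ (_ᵀ ℝ M) (𝟙 ℝ) i x

    rows-last : ∀ M j i → rows M (last j) i ≈ 𝟙 ℝ j i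
    rows-last M j i = trans (reflexive ([∣]-last (λ x → M x i) (𝟙 ℝ i) j)) (𝟙-sym i j)

    rows-inject : ∀ M x i → rows M (inject x) i ≈ M x i
    rows-inject M x i = reflexive ([∣]-inject (λ x → M x i) (𝟙 ℝ i) x)

  module Complementarity {n} {b : Fin n → ℕ} (M : N b → Fin n → Carrier)
    (s : Fin n → Carrier) (s²≈1 : ∀ j → s j * s j ≈ 1#) where

    open IsSum (sum-N {n} {b}) using () renaming (∑-cong to ∑ᴺ-cong)
    open Index (ix-N {n} {b}) using () renaming (∑ to ∑ᴺ)
    open Index (ix-N {n} {b +𝟏}) using () renaming (∑ to ∑ᴺ⁺)
    open SetoidReasoning setoid

    R : N (b +𝟏) → Fin n → Carrier
    R = rows M

    s[sx]≈x : ∀ j x → s j * (s j * x) ≈ x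
    s[sx]≈x j x = trans (sym (*-assoc _ _ _)) (trans (*-congʳ (s²≈1 j)) (*-identityˡ x))

    s-cancel : ∀ j {x y} → s j * x ≈ s j * y → x ≈ y
    s-cancel j {x} {y} eq = trans (sym (s[sx]≈x j x)) (trans (*-congˡ eq) (s[sx]≈x j y))

    M″ : N b → Fin n → Carrier
    M″ = _⊗_ ℝ (_⊗_ ℝ (diag ℝ λ (j , _) → s j) M) (diag ℝ s)

    [I∣-M″] : N b → N (b +𝟏) → Carrier
    [I∣-M″] = [_∣_] ℝ (𝟙 ℝ) (neg ℝ M″)

    M″-entry : ∀ x l → M″ x l ≈ s (proj₁ x) * M x l * s l
    M″-entry x l = trans (∑-diagʳ s l (λ k → ∑ᴺ (λ w → diag ℝ (λ (j , _) → s j) x w * M w k)))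
      (*-congʳ (∑-diag (λ (j , _) → s j) x (λ w → M w l)))

    M″-dot : ∀ x (z : Fin n → Carrier) → sum (λ l → - M″ x l * (s l * z l)) ≈ - (s (proj₁ x) * dot (M x) z)
    M″-dot x z = begin
      sum (λ l → - M″ x l * (s l * z l))           ≈⟨ sum-cong-≋ (λ l → *-congʳ (-‿cong (M″-entry x l))) ⟩
      sum (λ l → - (σ * M x l * s l) * (s l * z l)) ≈⟨ sum-cong-≋ (λ l → trans (sym (-‿distribˡ-* _ _)) (-‿cong (collect l))) ⟩
      sum (λ l → - (σ * (M x l * z l)))            ≈⟨ sum-cong-≋ (λ l → -‿distribˡ-* σ (M x l * z l)) ⟩
      sum (λ l → - σ * (M x l * z l))              ≈⟨ *-distribˡ-sum (- σ) (λ l → M x l * z l) ⟨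
      - σ * dot (M x) z                            ≈⟨ -‿distribˡ-* σ (dot (M x) z) ⟨
      - (σ * dot (M x) z)                          ∎
      where
      σ : Carrier
      σ = s (proj₁ x)
      collect : ∀ l → σ * M x l * s l * (s l * z l) ≈ σ * (M x l * z l)
      collect l = trans (*-assoc _ _ _) (trans (*-congˡ (s[sx]≈x l (z l))) (*-assoc _ _ _))

    module _ (B : Vertex (b +𝟏)) where

      -- As e vanishes on B, the sum over the complement of B is a sum over all of `N (b +𝟏)`. That
      -- sum can be split at the last actions, where the blocks of `[I∣-M″]` are known, whatever B
      -- is. The signs inside M″ cancel against those of v because they square to one.
      columns-apply : ∀ (e : N (b +𝟏) → Carrier) → (∀ j → e (basic B j) ≈ 0#) →
        ∀ (v : N b → Carrier) → (∀ k → v k ≈ s (proj₁ k) * e (nonbasic B k)) →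
        ∀ x → ∑ᴺ (λ k → [I∣-M″] x (nonbasic B k) * v k) ≈ s (proj₁ x) * (e (inject x) - dot (M x) (e ∘ last))
      columns-apply e e-basic v v≈se x = begin
        ∑ᴺ (λ k → [I∣-M″] x (nonbasic B k) * v k)                                  ≈⟨ ∑ᴺ-cong (λ k → *-congˡ (v≈se k)) ⟩
        ∑ᴺ (f ∘ nonbasic B)                                                        ≈⟨ +-identityˡ _ ⟨
        0# + ∑ᴺ (f ∘ nonbasic B)                                                   ≈⟨ +-congʳ (sum-zero f-basic) ⟨
        sum (f ∘ basic B) + ∑ᴺ (f ∘ nonbasic B)                                    ≈⟨ ∑-basic B f ⟨
        ∑ᴺ⁺ f                                                                      ≈⟨ ∑-last f ⟩
        ∑ᴺ (f ∘ inject) + sum (f ∘ last)                                           ≈⟨ +-cong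
          (∑ᴺ-cong λ k → *-congʳ {s (proj₁ k) * e (inject k)} (reflexive ([∣]-inject (𝟙 ℝ x) (λ l → - M″ x l) k)))
          (sum-cong-≋ λ l → *-congʳ (reflexive ([∣]-last (𝟙 ℝ x) (λ l → - M″ x l) l))) ⟩
        ∑ᴺ (λ k → 𝟙 ℝ x k * (s (proj₁ k) * e (inject k))) + sum (λ l → - M″ x l * (s l * e (last l)))
          ≈⟨ +-cong (∑-𝟙 x (λ k → s (proj₁ k) * e (inject k))) (M″-dot x (e ∘ last)) ⟩
        s (proj₁ x) * e (inject x) - s (proj₁ x) * dot (M x) (e ∘ last)            ≈⟨ x[y-z]≈xy-xz _ _ _ ⟨
        s (proj₁ x) * (e (inject x) - dot (M x) (e ∘ last))                        ∎
        where
        f : N (b +𝟏) → Carrier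
        f w = [I∣-M″] x w * (s (proj₁ w) * e w)
        f-basic : ∀ j → f (basic B j) ≈ 0#
        f-basic j = trans (*-congˡ (trans (*-congˡ (e-basic j)) (zeroʳ (s j)))) (zeroʳ _)

      -- The residual c − Ru of c = [q ∣ 0], when u is chosen to annihilate it on
      -- B, is up to signs the complementary solution at B.
      module _ (q : N b → Carrier) (u : Fin n → Carrier) where

        residual : N (b +𝟏) → Carrier
        residual x = [_∣_]ᵛ ℝ q (λ _ → 0#) x - dot (R x) u

        -- On the last rows R is the identity and the cost is zero, so the residual is - u there; on
        -- the other rows it is q - Mu. In the combination formed by `columns-apply` the terms Mu
        -- cancel.
        columns-residual : (∀ j → dot (R (basic B j)) u ≈ [_∣_]ᵛ ℝ q (λ _ → 0#) (basic B j)) →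
          ∀ x → ∑ᴺ (λ k → [I∣-M″] x (nonbasic B k) * (s (proj₁ k) * residual (nonbasic B k))) ≈ s (proj₁ x) * q x
        columns-residual Ru≈c x = trans
          (columns-apply residual (λ j → trans (+-congʳ (sym (Ru≈c j))) (-‿inverseʳ _)) _ (λ _ → refl) x)
          (*-congˡ (begin
            residual (inject x) - dot (M x) (residual ∘ last)      ≈⟨ +-cong residual-inject (-‿cong (dot-congʳ (M x) residual-last)) ⟩
            (q x - dot (M x) u) - dot (M x) (λ l → - u l)          ≈⟨ +-congˡ (trans (-‿cong (dot-neg (M x) u)) (-‿involutive _)) ⟩
            (q x - dot (M x) u) + dot (M x) u                      ≈⟨ [x-y]+y≈x _ _ ⟩
            q x                                                    ∎))
          where
          residual-inject : residual (inject x) ≈ q x - dot (M x) u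
          residual-inject = +-cong (reflexive ([∣]-inject q (λ _ → 0#) x)) (-‿cong (dot-congˡ u (rows-inject M x)))
          residual-last : ∀ l → residual (last l) ≈ - u l
          residual-last l = trans
            (+-cong (reflexive ([∣]-last q (λ _ → 0#) l)) (-‿cong (trans (dot-congˡ u (rows-last M l)) (∑-𝟙 l u))))
            (+-identityˡ _)

        complementary-solution : (∀ j → dot (R (basic B j)) u ≈ [_∣_]ᵛ ℝ q (λ _ → 0#) (basic B j)) →
          (V : Inverse ℝ (columns ℝ [I∣-M″] (nonbasic B))) (q″ : N b → Carrier) → (∀ x → q″ x ≈ s (proj₁ x) * q x) →
          ∀ k → _⊗ᵛ_ ℝ (Inverse.mat V) q″ k ≈ s (proj₁ k) * residual (nonbasic B k)
        complementary-solution Ru≈c V q″ q″≈sq k = begin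
          ∑ᴺ (λ x → mat k x * q″ x)                                ≈⟨ ∑ᴺ-cong (λ x → *-congˡ (trans (q″≈sq x) (sym (columns-residual Ru≈c x)))) ⟩
          ∑ᴺ (λ x → mat k x * ∑ᴺ (λ l → [I∣-M″] x (nonbasic B l) * v l))  ≈⟨ ∑-assoc (mat k) (columns ℝ [I∣-M″] (nonbasic B)) v ⟩
          ∑ᴺ (λ l → ∑ᴺ (λ x → mat k x * [I∣-M″] x (nonbasic B l)) * v l)  ≈⟨ ∑ᴺ-cong (λ l → *-congʳ (invˡ k l)) ⟩
          ∑ᴺ (λ l → 𝟙 ℝ k l * v l)                                 ≈⟨ ∑-𝟙 k v ⟩
          v k                                                      ∎
          where
          open Inverse V
          v : N b → Carrier
          v k = s (proj₁ k) * residual (nonbasic B k)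

      module _ (R-solvable : Solvable (R ∘ basic B))
               (R-injective : ∀ v w → (∀ j → dot (R (basic B j)) v ≈ dot (R (basic B j)) w) → ∀ j → v j ≈ w j) where

        -- Zeros on B bring a vector on the complement into the form required by `columns-apply`.
        extend : (N b → Carrier) → N (b +𝟏) → Carrier
        extend v (j , i) = insertAt (λ k → s j * v (j , k)) (B j) 0# i

        extend-basic : ∀ v j → extend v (basic B j) ≈ 0#
        extend-basic v j = reflexive (insertAt-lookup _ (B j) 0#)

        extend-nonbasic : ∀ v k → extend v (nonbasic B k) ≈ s (proj₁ k) * v k
        extend-nonbasic v (j , i) = reflexive (insertAt-punchIn (λ k → s j * v (j , k)) (B j) 0# i)

        -- Equal images mean equal slacks. Since both extensions vanish on B, the slacks fix the
        -- value of R_B at their last entries, and injectivity of R_B makes the last entries equal;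
        -- together with the slacks these determine everything else.
        columns-injective : ∀ (v w : N b → Carrier) →
          (∀ x → ∑ᴺ (λ k → [I∣-M″] x (nonbasic B k) * v k) ≈ ∑ᴺ (λ k → [I∣-M″] x (nonbasic B k) * w k)) →
          ∀ k → v k ≈ w k
        columns-injective v w eq (j , i) = s-cancel j (begin
          s j * v (j , i)                  ≈⟨ extend-nonbasic v (j , i) ⟨
          extend v (nonbasic B (j , i))    ≈⟨ extend-≈ j (punchIn (B j) i) ⟩
          extend w (nonbasic B (j , i))    ≈⟨ extend-nonbasic w (j , i) ⟩
          s j * w (j , i)                  ∎)
          where
          slack : (N b → Carrier) → N b → Carrier
          slack v x = extend v (inject x) - dot (M x) (extend v ∘ last)
          slack-≈ : ∀ x → slack v x ≈ slack w x
          slack-≈ x = s-cancel (proj₁ x) (begin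
            s (proj₁ x) * slack v x                        ≈⟨ apply v ⟨
            ∑ᴺ (λ k → [I∣-M″] x (nonbasic B k) * v k)      ≈⟨ eq x ⟩
            ∑ᴺ (λ k → [I∣-M″] x (nonbasic B k) * w k)      ≈⟨ apply w ⟩
            s (proj₁ x) * slack w x                        ∎)
            where
            apply : ∀ v → ∑ᴺ (λ k → [I∣-M″] x (nonbasic B k) * v k) ≈ s (proj₁ x) * slack v x
            apply v = columns-apply (extend v) (extend-basic v) v
              (λ k → sym (trans (*-congˡ (extend-nonbasic v k)) (s[sx]≈x (proj₁ k) (v k)))) x
          dot-last : ∀ v x → dot (M x) (extend v ∘ last) ≈ extend v (inject x) - slack v x
          dot-last v x = sym (trans (+-congʳ (sym ([x-y]+y≈x _ (dot (M x) (extend v ∘ last)))))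
            (trans (+-congʳ (+-comm _ _)) ([x+y]-y≈x _ _)))
          R-extend : ∀ j i → extend v (j , i) ≈ 0# → extend w (j , i) ≈ 0# →
                     dot (R (j , i)) (extend v ∘ last) ≈ dot (R (j , i)) (extend w ∘ last)
          R-extend j = top-elim
            (λ i → extend v (j , i) ≈ 0# → extend w (j , i) ≈ 0# → dot (R (j , i)) (extend v ∘ last) ≈ dot (R (j , i)) (extend w ∘ last))
            (λ v≈0 w≈0 → trans (R-last v) (trans v≈0 (trans (sym w≈0) (sym (R-last w)))))
            (λ i v≈0 w≈0 → trans (R-inject v i) (trans (+-cong (trans v≈0 (sym w≈0)) (-‿cong (slack-≈ (j , i)))) (sym (R-inject w i))))
            where
            R-last : ∀ v → dot (R (last j)) (extend v ∘ last) ≈ extend v (last j)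
            R-last v = trans (dot-congˡ (extend v ∘ last) (rows-last M j)) (∑-𝟙 j (extend v ∘ last))
            R-inject : ∀ v i → dot (R (inject (j , i))) (extend v ∘ last) ≈ extend v (inject (j , i)) - slack v (j , i)
            R-inject v i = trans (dot-congˡ (extend v ∘ last) (rows-inject M (j , i))) (dot-last v (j , i))
          last-≈ : ∀ j → extend v (last j) ≈ extend w (last j)
          last-≈ = R-injective (extend v ∘ last) (extend w ∘ last)
            λ j → R-extend j (B j) (extend-basic v j) (extend-basic w j)
          extend-≈ : ∀ j i → extend v (j , i) ≈ extend w (j , i)
          extend-≈ j = top-elim (λ i → extend v (j , i) ≈ extend w (j , i)) (last-≈ j) λ i → begin
            extend v (inject (j , i))                               ≈⟨ [x-y]+y≈x _ _ ⟨
            slack v (j , i) + dot (M (j , i)) (extend v ∘ last)     ≈⟨ +-cong (slack-≈ (j , i)) (dot-congʳ (M (j , i)) last-≈) ⟩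
            slack w (j , i) + dot (M (j , i)) (extend w ∘ last)     ≈⟨ [x-y]+y≈x _ _ ⟩
            extend w (inject (j , i))                               ∎

        columns-inverse : Inverse ℝ (columns ℝ [I∣-M″] (nonbasic B))
        columns-inverse = inverse-of-injective (columns ℝ [I∣-M″] (nonbasic B)) V right columns-injective
          where
          -- Column k of the inverse is a residual. The factor s in q undoes the one that
          -- `columns-residual` produces, which leaves the unit vector.
          q : N b → N b → Carrier
          q k x = s (proj₁ x) * 𝟙 ℝ x k
          solution : ∀ k → ∃ λ u → ∀ j → dot (R (basic B j)) u ≈ [_∣_]ᵛ ℝ (q k) (λ _ → 0#) (basic B j)
          solution k = R-solvable (λ j → [_∣_]ᵛ ℝ (q k) (λ _ → 0#) (basic B j))
          V : N b → N b → Carrier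
          V l k = s (proj₁ l) * residual (q k) (proj₁ (solution k)) (nonbasic B l)
          right : ∀ x k → ∑ᴺ (λ l → [I∣-M″] x (nonbasic B l) * V l k) ≈ 𝟙 ℝ x k
          right x k = trans (columns-residual (q k) (proj₁ (solution k)) (proj₂ (solution k)) x) (s[sx]≈x (proj₁ x) _)

  -- Orientations, grid LPs and games

  module _ {n} {b : Fin n → ℕ} {φ : Orientation (b +𝟏)} where
    open Orientation φ

    IsInduced-≐ : ∀ {ψ f} → φ ≐ ψ → IsInduced φ f → IsInduced ψ f
    IsInduced-≐ φ≐ψ φ-f = record
      { nonzero = nonzero
      ; induced = λ B k → mk⇔
          (Equivalence.to (induced B k) ∘ Equivalence.from (φ≐ψ B (neighbour B k)))
          (Equivalence.to (φ≐ψ B (neighbour B k)) ∘ Equivalence.from (induced B k))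
      }
      where open IsInduced φ-f

    IsInduced-scale : ∀ {f g} (d : Vertex (b +𝟏) → N b → Carrier) → (∀ B k → 0# < d B k) →
                      (∀ B k → g B k ≈ d B k * f B k) → IsInduced φ f → IsInduced φ g
    IsInduced-scale {f} {g} d d-pos g≈df φ-f = record
      { nonzero = λ B k g≈0 → nonzero B k (f≈0 (trans (sym (g≈df B k)) g≈0) (d-pos B k))
      ; induced = λ B k → mk⇔ (g<0 ∘ Equivalence.to (induced B k)) (Equivalence.from (induced B k) ∘ f<0)
      }
      where
      open IsInduced φ-f
      f≈0 : ∀ {x y} → x * y ≈ 0# → 0# < x → y ≈ 0#
      f≈0 {x} {y} xy≈0 0<x = begin
        y                      ≈⟨ *-identityˡ y ⟨
        1# * y                 ≈⟨ *-congʳ (trans (*-comm _ x) (*-recip 0<x)) ⟨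
        recip 0<x * x * y      ≈⟨ *-assoc _ x y ⟩
        recip 0<x * (x * y)    ≈⟨ *-congˡ xy≈0 ⟩
        recip 0<x * 0#         ≈⟨ zeroʳ _ ⟩
        0#                     ∎
        where open SetoidReasoning setoid
      g<0 : ∀ {B k} → f B k < 0# → g B k < 0#
      g<0 {B} {k} f<0 = <-respˡ-≈ (sym (g≈df B k)) (<-respʳ-≈ (zeroʳ _) (*-monoˡ-< (d-pos B k) f<0))
      f<0 : ∀ {B k} → g B k < 0# → f B k < 0#
      f<0 {B} {k} g<0 = ≰⇒> λ 0≤f → ≤⇒≯ (*-nonneg (inj₁ (d-pos B k)) 0≤f) (<-respˡ-≈ (g≈df B k) g<0)

    ^-involutive : ∀ F → φ ≐ φ ^ F ^ F
    ^-involutive F B C = mk⇔ to from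
      where
      to : B ⟶ C → Orientation._⟶_ (φ ^ F ^ F) B C
      to B⟶C with ⟶-edge B⟶C
      ... | j , e with j ∈? F
      ... | yes j∈F = j , e , inj₁ (j∈F , j , ∼-sym e , inj₁ (j∈F , B⟶C))
      ... | no  j∉F = j , e , inj₂ (j∉F , j , e , inj₂ (j∉F , B⟶C))
      from : Orientation._⟶_ (φ ^ F ^ F) B C → B ⟶ C
      from (j , e , inj₁ (j∈F , _ , _ , inj₁ (_ , B⟶C)))   = B⟶C
      from (j , e , inj₁ (j∈F , l , e′ , inj₂ (l∉F , _)))  =
        contradiction (≡.subst (_∈ F) (direction-unique e e′) j∈F) l∉F
      from (j , e , inj₂ (j∉F , l , e′ , inj₁ (l∈F , _)))  =
        contradiction (≡.subst (_∈ F) (≡.sym (direction-unique e (∼-sym e′))) l∈F) j∉F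
      from (j , e , inj₂ (j∉F , _ , _ , inj₂ (_ , B⟶C)))   = B⟶C

  sign² : ∀ o → sign ℝ o * sign ℝ o ≈ 1#
  sign² max = *-identityˡ 1#
  sign² min = trans (-1*x≈-x (- 1#)) (-‿involutive 1#)

  module _ {n} {b : Fin n → ℕ} {φ : Orientation (b +𝟏)} {f g : Vertex (b +𝟏) → N b → Carrier}
    (F : Subset n) (owner : Fin n → Player)
    (F⇒min : ∀ {j} → j ∈ F → owner j ≡ min) (∉F⇒max : ∀ {j} → j ∉ F → owner j ≡ max)
    (g≈sf : ∀ B k → g B k ≈ sign ℝ (owner (proj₁ k)) * f B k) where
    open Orientation φ

    -- The entry at one end settles an edge: if the edge does not leave B, totality makes it enter
    -- B. So a change of sign in block j reverses the edges of direction j.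
    IsInduced-^ : IsInduced φ f → IsInduced (φ ^ F) g
    IsInduced-^ φ-f = record
      { nonzero = λ B k g≈0 → nonzero B k (f≈0 B k g≈0)
      ; induced = λ B k → mk⇔ (to B k) (from B k)
      }
      where
      open IsInduced φ-f
      f≈sg : ∀ B k → f B k ≈ sign ℝ (owner (proj₁ k)) * g B k
      f≈sg B (j , i) = begin
        f B (j , i)               ≈⟨ *-identityˡ _ ⟨
        1# * f B (j , i)          ≈⟨ *-congʳ (sign² (owner j)) ⟨
        σ * σ * f B (j , i)       ≈⟨ *-assoc σ σ _ ⟩
        σ * (σ * f B (j , i))     ≈⟨ *-congˡ (g≈sf B (j , i)) ⟨
        σ * g B (j , i)           ∎
        where
        open SetoidReasoning setoid
        σ : Carrier
        σ = sign ℝ (owner j)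
      f≈0 : ∀ B k → g B k ≈ 0# → f B k ≈ 0#
      f≈0 B k g≈0 = trans (f≈sg B k) (trans (*-congˡ g≈0) (zeroʳ _))
      f≈-g : ∀ B {j i} → j ∈ F → f B (j , i) ≈ - g B (j , i)
      f≈-g B {j} {i} j∈F = trans (f≈sg B (j , i)) (trans (*-congʳ (reflexive (≡.cong (sign ℝ) (F⇒min j∈F)))) (-1*x≈-x _))
      f≈g : ∀ B {j i} → j ∉ F → f B (j , i) ≈ g B (j , i)
      f≈g B {j} {i} j∉F = trans (f≈sg B (j , i)) (trans (*-congʳ (reflexive (≡.cong (sign ℝ) (∉F⇒max j∉F)))) (*-identityˡ _))
      to : ∀ B k → Orientation._⟶_ (φ ^ F) B (neighbour B k) → g B k < 0#
      to B (j , i) (j′ , e , d) with direction-unique e (∼-sym (neighbour-∼ B j i))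
      to B (j , i) (_ , e , inj₁ (j∈F , C⟶B)) | ≡.refl = ≰⇒> λ 0≤g →
        [ (λ f<0 → ⟶-asym (Equivalence.from (induced B (j , i)) f<0) C⟶B) , nonzero B (j , i) ]
          (≤-trans (≤-reflexive (f≈-g B j∈F)) (≤-trans (neg-antimono-≤ 0≤g) (≤-reflexive -0#≈0#)))
      to B (j , i) (_ , e , inj₂ (j∉F , B⟶C)) | ≡.refl =
        <-respˡ-≈ (f≈g B j∉F) (Equivalence.to (induced B (j , i)) B⟶C)
      from : ∀ B k → g B k < 0# → Orientation._⟶_ (φ ^ F) B (neighbour B k)
      from B (j , i) g<0 with j ∈? F
      ... | no j∉F  = j , neighbour-∼ B j i ,
        inj₂ (j∉F , Equivalence.from (induced B (j , i)) (<-respˡ-≈ (sym (f≈g B j∉F)) g<0))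
      ... | yes j∈F with ⟶-total (neighbour-∼ B j i)
      ... | inj₂ C⟶B = j , neighbour-∼ B j i , inj₁ (j∈F , C⟶B)
      ... | inj₁ B⟶C = contradiction (Equivalence.to (induced B (j , i)) B⟶C)
        (asym (<-respʳ-≈ (sym (f≈-g B j∈F)) (x<0⇒0<-x g<0)))

  -- Basic solutions and dual vectors of a grid LP

  module GridLPProperties {n} {b : Fin n → ℕ} (lp : GridLP ℝ b) where
    open GridLP lp
    open Inverse using (mat; invˡ; invʳ)

    R : N (b +𝟏) → Fin n → Carrier
    R = rows M

    primal : Vertex (b +𝟏) → Fin n → Carrier
    primal B = _⊗ᵛ_ ℝ (mat (A⁻¹ B)) p

    primal-feasible : ∀ B i → sum (λ j → primal B j * R (basic B j) i) ≈ p i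
    primal-feasible B i = begin
      dot (primal B) (λ j → R (basic B j) i)                              ≈⟨ dot-comm (primal B) (λ j → R (basic B j) i) ⟩
      sum (λ j → R (basic B j) i * dot (mat (A⁻¹ B) j) p)                 ≈⟨ ∑-assoc (λ j → R (basic B j) i) (mat (A⁻¹ B)) p ⟩
      sum (λ k → sum (λ j → R (basic B j) i * mat (A⁻¹ B) j k) * p k)     ≈⟨ dot-congˡ p (λ k → invʳ (A⁻¹ B) i k) ⟩
      dot (𝟙 ℝ i) p                                                       ≈⟨ ∑-𝟙 i p ⟩
      p i                                                                 ∎
      where open SetoidReasoning setoid

    -- The vector c_Bᵀ A_B⁻¹ for any cost c, since the construction of a game also needs it at
    -- auxiliary costs.
    dual : (N (b +𝟏) → Carrier) → Vertex (b +𝟏) → Fin n → Carrier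
    dual c B i = sum λ j → mat (A⁻¹ B) j i * c (basic B j)

    dual-row : ∀ c B x → dot (R x) (dual c B) ≈ sum (λ j → sum (λ i → mat (A⁻¹ B) j i * R x i) * c (basic B j))
    dual-row c B x = trans (∑-assoc (R x) (λ i j → mat (A⁻¹ B) j i) (c ∘ basic B))
      (dot-congˡ (c ∘ basic B) λ j → dot-comm (R x) (mat (A⁻¹ B) j))

    dual-basic : ∀ c B j → dot (R (basic B j)) (dual c B) ≈ c (basic B j)
    dual-basic c B j = trans (dual-row c B (basic B j)) (trans
      (dot-congˡ (c ∘ basic B) λ l → trans (invˡ (A⁻¹ B) l j) (𝟙-sym l j))
      (∑-𝟙 j (c ∘ basic B)))

    reducedCost-dual : ∀ B k → reducedCost B k + dot (R (nonbasic B k)) (dual cost B) ≈ cost (nonbasic B k)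
    reducedCost-dual B k = trans (+-congˡ (dual-row cost B (nonbasic B k))) ([x-y]+y≈x _ _)

    open LinearProgram R p primal feasible primal-feasible public

    reducedCost-USO : ∀ {φ} → IsInduced φ reducedCost → IsUSO φ
    reducedCost-USO {φ} φ-rc = reducedCost-isUSO R p primal feasible primal-feasible
      φ reducedCost φ-rc cost (dual cost) (dual-basic cost) reducedCost-dual

  -- The matrix E - γP of a game

  module GameProperties {n} {b : Fin n → ℕ} (G : Game ℝ (b +𝟏)) where
    open Game G
    open GameMatrices ℝ G

    L : N (b +𝟏) → Fin n → Carrier
    L x k = 𝟙 ℝ (proj₁ x) k - γ * P x k

    ones : Fin n → Carrier
    ones _ = 1#

    L-sum : ∀ x → dot (L x) ones ≈ 1# - γ
    L-sum x = begin
      sum (λ k → (𝟙 ℝ j k - γ * P x k) * 1#)             ≈⟨ sum-cong-≋ (λ k → *-identityʳ (L x k)) ⟩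
      sum (λ k → 𝟙 ℝ j k - γ * P x k)                    ≈⟨ sum-cong-≋ (λ k → +-cong (sym (*-identityʳ _)) (-‿distribˡ-* γ (P x k))) ⟩
      sum (λ k → 𝟙 ℝ j k * 1# + - γ * P x k)             ≈⟨ ∑-distrib-+ (λ k → 𝟙 ℝ j k * 1#) (λ k → - γ * P x k) ⟩
      dot (𝟙 ℝ j) ones + sum (λ k → - γ * P x k)         ≈⟨ +-cong (∑-𝟙 j ones) (trans (sym (*-distribˡ-sum (- γ) (P x))) (*-congˡ (P-sum x))) ⟩
      1# + - γ * 1#                                      ≈⟨ +-congˡ (*-identityʳ (- γ)) ⟩
      1# - γ                                             ∎
      where
      open SetoidReasoning setoid
      j : Fin n
      j = proj₁ x

    -- Whichever actions B selects, the off-diagonal entries are - γP ≤ 0 and every row sums to 1 -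
    -- γ > 0.
    L-isM : ∀ B → IsMMatrix (L ∘ basic {b = b} B) ones
    L-isM B = record
      { offdiag = λ i j i≢j → begin
          𝟙 ℝ i j - γ * P (basic B i) j    ≈⟨ +-congʳ (diag-other _ i≢j) ⟩
          0# - γ * P (basic B i) j         ≈⟨ +-identityˡ _ ⟩
          - (γ * P (basic B i) j)          ≤⟨ neg-antimono-≤ (*-nonneg 0≤γ (P≥0 _ j)) ⟩
          - 0#                             ≈⟨ -0#≈0# ⟩
          0#                               ∎
      ; x-pos   = λ _ → 0<1
      ; Wx-pos  = λ i → <-respʳ-≈ (sym (L-sum (basic B i))) (x<y⇒0<y-x γ<1)
      }
      where open ≤-Reasoning

    module _ (V : Inverse ℝ (_⊖_ ℝ (𝟙 ℝ) (_⊙_ ℝ γ P-C))) where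
      open Inverse V

      R : N (b +𝟏) → Fin n → Carrier
      R = rows (M′ V)

      -- The unit rows below M′ fit the same formula: on the last actions L is I - γP_C, which the
      -- inverse cancels.
      rows-M′ : ∀ x i → R x i ≈ sum (λ k → L x k * mat k i)
      rows-M′ (j , k) i = top-elim (λ k → R (j , k) i ≈ sum (λ l → L (j , k) l * mat l i))
        (trans (rows-last (M′ V) j i) (sym (invʳ j i)))
        (λ k → rows-inject (M′ V) (j , k) i) k

      dot-rows-M′ : ∀ x u → dot (R x) u ≈ dot (L x) (λ k → dot (mat k) u)
      dot-rows-M′ x u = trans (dot-congˡ u (rows-M′ x)) (sym (∑-assoc (L x) mat u))

      mat-L : ∀ v i → sum (λ j → mat i j * dot (L (last {b = b} j)) v) ≈ v i
      mat-L v i = trans (∑-assoc (mat i) (L ∘ last) v) (trans (dot-congˡ v (invˡ i)) (∑-𝟙 i v))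

      L-mat : ∀ u j → dot (L (last {b = b} j)) (λ k → dot (mat k) u) ≈ u j
      L-mat u j = trans (∑-assoc (L (last j)) mat u) (trans (dot-congˡ u (invʳ j)) (∑-𝟙 j u))

      -- From R_B = L_B L_C⁻¹: if L_B v = r, then u = L_C v satisfies R_B u = r.
      R-solvable : ∀ B → Solvable (R ∘ basic B)
      R-solvable B r = u , λ j → trans (dot-rows-M′ (basic B j) u)
          (trans (dot-congʳ (L (basic B j)) (mat-L v)) (Lv≈r j))
        where
        v u : Fin n → Carrier
        v = proj₁ (M-matrix-solvable (L-isM B) r)
        u j = dot (L (last j)) v
        Lv≈r : ∀ j → dot (L (basic B j)) v ≈ r j
        Lv≈r = proj₂ (M-matrix-solvable (L-isM B) r)

      R-injective : ∀ B v w → (∀ j → dot (R (basic B j)) v ≈ dot (R (basic B j)) w) → ∀ j → v j ≈ w j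
      R-injective B v w eq j = trans (sym (L-mat v j)) (trans (dot-congʳ (L (last j)) Vv≈Vw) (L-mat w j))
        where
        Vv≈Vw : ∀ k → dot (mat k) v ≈ dot (mat k) w
        Vv≈Vw = injective (L-isM B) _ _ λ j → trans (sym (dot-rows-M′ (basic B j) v)) (trans (eq j) (dot-rows-M′ (basic B j) w))

      q″≈sq′ : ∀ x → q″ V x ≈ sign ℝ (owner (proj₁ x)) * q′ V x
      q″≈sq′ x = ∑-diag (λ (j , _) → sign ℝ (owner j)) x (q′ V)

  -- From a game to a grid LP

  module FromGame {n} {b : Fin n → ℕ} (ψ : Orientation (b +𝟏)) (arises : ArisesFromNondegenerateGame ℝ ψ) where
    open ArisesFromNondegenerateGame arises
    open Game game
    open GameMatrices ℝ game using (M′; q′; q″)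
    open GameProperties game
    private
      V = [I-γP-C]⁻¹
      module V = Inverse V

    p : Fin n → Carrier
    p i = sum λ k → 1# * V.mat k i

    L⁻¹ : ∀ B → Inverse ℝ (L ∘ basic {b = b} B)
    L⁻¹ B = M-matrix-inverse (L-isM B)

    -- Since xᵀL_B = 1ᵀ, this is the solution of xᵀR_B = 1ᵀV = pᵀ.
    flow : Vertex (b +𝟏) → Fin n → Carrier
    flow B j = sum λ k → 1# * Inverse.mat (L⁻¹ B) k j

    -- The flow counts the expected discounted visits to state j under the actions B when one unit
    -- starts in each state. The unit starting in j itself already contributes a positive amount,
    -- the diagonal entry of L_B⁻¹; the other contributions are nonnegative.
    flow-pos : ∀ B j → 0# < flow B j
    flow-pos B j = sum-pos (λ k → *-nonneg 0≤1 (nonneg k)) j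
      (*-pos 0<1 (strictly-monotone (IsMMatrix.offdiag (L-isM B)) nonneg j
        (<-respʳ-≈ (sym (trans (Inverse.invʳ (L⁻¹ B) j j) (diag-same _ j))) 0<1)))
      where
      nonneg : ∀ k → 0# ≤ Inverse.mat (L⁻¹ B) k j
      nonneg k = M-matrix-inverse-nonneg (L-isM B) (L⁻¹ B) k j

    flow-L : ∀ B k → sum (λ j → flow B j * L (basic B j) k) ≈ 1#
    flow-L B k = begin
      sum (λ j → flow B j * L (basic B j) k)                                      ≈⟨ ∑-assoc ones (Inverse.mat (L⁻¹ B)) (λ j → L (basic B j) k) ⟨
      sum (λ l → 1# * sum (λ j → Inverse.mat (L⁻¹ B) l j * L (basic B j) k))      ≈⟨ sum-cong-≋ (λ l → *-congˡ (Inverse.invˡ (L⁻¹ B) l k)) ⟩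
      sum (λ l → 1# * 𝟙 ℝ l k)                                                    ≈⟨ ∑-𝟙ʳ k ones ⟩
      1#                                                                          ∎
      where open SetoidReasoning setoid

    flow-feasible : ∀ B i → sum (λ j → flow B j * R V (basic B j) i) ≈ p i
    flow-feasible B i = begin
      sum (λ j → flow B j * R V (basic B j) i)                                    ≈⟨ sum-cong-≋ (λ j → *-congˡ (rows-M′ V (basic B j) i)) ⟩
      sum (λ j → flow B j * sum (λ k → L (basic B j) k * V.mat k i))              ≈⟨ ∑-assoc (flow B) (L ∘ basic B) (λ k → V.mat k i) ⟩
      sum (λ k → sum (λ j → flow B j * L (basic B j) k) * V.mat k i)              ≈⟨ sum-cong-≋ (λ k → *-congʳ (flow-L B k)) ⟩
      p i                                                                         ∎
      where open SetoidReasoning setoid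

    A⁻¹ : ∀ B → Inverse ℝ (_ᵀ ℝ (R V ∘ basic B))
    A⁻¹ B = transpose-inverse (solvable-inverse (R-solvable V B) (R-injective V B))

    A⁻¹p≈flow : ∀ B j → dot (Inverse.mat (A⁻¹ B) j) p ≈ flow B j
    A⁻¹p≈flow B j = begin
      dot (mat j) p                                                               ≈⟨ dot-congʳ (mat j) (λ i → trans (dot-comm (λ l → R V (basic B l) i) (flow B)) (flow-feasible B i)) ⟨
      dot (mat j) (λ i → dot (λ l → R V (basic B l) i) (flow B))                  ≈⟨ ∑-assoc (mat j) (λ i l → R V (basic B l) i) (flow B) ⟩
      dot (λ l → dot (mat j) (R V (basic B l))) (flow B)                          ≈⟨ dot-congˡ (flow B) (invˡ j) ⟩
      dot (𝟙 ℝ j) (flow B)                                                        ≈⟨ ∑-𝟙 j (flow B) ⟩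
      flow B j                                                                    ∎
      where
      open SetoidReasoning setoid
      open Inverse (A⁻¹ B)

    gridLP : GridLP ℝ b
    gridLP = record
      { M        = M′ V
      ; p        = p
      ; q        = q′ V
      ; A⁻¹      = A⁻¹
      ; feasible = λ B j → <-respʳ-≈ (sym (A⁻¹p≈flow B j)) (flow-pos B j)
      }
    open GridLP gridLP using (cost; reducedCost)
    open GridLPProperties gridLP using (dual; dual-basic; reducedCost-dual; reducedCost-USO)
    open Complementarity (M′ V) (sign ℝ ∘ owner) (sign² ∘ owner) using (complementary-solution; residual)

    value≈ : ∀ B k → value B k ≈ sign ℝ (owner (proj₁ k)) * reducedCost B k
    value≈ B k = trans
      (complementary-solution B (q′ V) (dual cost B) (dual-basic cost B) ([I∣-M″]⁻¹ B) (q″ V) (q″≈sq′ V) k)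
      (*-congˡ (trans (+-congʳ (sym (reducedCost-dual B k))) ([x+y]-y≈x _ _)))

    reducedCost≈ : ∀ B k → reducedCost B k ≈ sign ℝ (owner (proj₁ k)) * value B k
    reducedCost≈ B k = sym (trans (*-congˡ (value≈ B k)) (trans (sym (*-assoc _ _ _))
      (trans (*-congʳ (sign² (owner (proj₁ k)))) (*-identityˡ _))))

    side : Player → Side
    side min = inside
    side max = outside

    -- The states of the minimising player, where value and reduced cost have opposite signs.
    F : Subset n
    F = tabulate (side ∘ owner)

    ∈F⇒min : ∀ {j} → j ∈ F → owner j ≡ min
    ∈F⇒min {j} j∈F = side-inside (≡.trans (≡.sym (lookup∘tabulate (side ∘ owner) j)) ([]=⇒lookup j∈F))
      where
      side-inside : ∀ {o} → side o ≡ inside → o ≡ min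
      side-inside {min} _ = ≡.refl

    ∉F⇒max : ∀ {j} → j ∉ F → owner j ≡ max
    ∉F⇒max {j} j∉F = not-min (owner j) λ owner≡min →
      j∉F (lookup⇒[]= j F (≡.trans (lookup∘tabulate (side ∘ owner) j) (≡.cong side owner≡min)))
      where
      not-min : ∀ o → o ≢ min → o ≡ max
      not-min max _     = ≡.refl
      not-min min o≢min = contradiction ≡.refl o≢min

    ψ^F-induced : IsInduced (ψ ^ F) reducedCost
    ψ^F-induced = IsInduced-^ F owner ∈F⇒min ∉F⇒max reducedCost≈
      (record { nonzero = nondegenerate ; induced = induced })

    ψ^F-LPUSO : IsLPUSO ℝ (ψ ^ F)
    ψ^F-LPUSO = record
      { lp                = gridLP
      ; dualNondegenerate = IsInduced.nonzero ψ^F-induced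
      ; induced           = IsInduced.induced ψ^F-induced
      ; isUSO             = reducedCost-USO ψ^F-induced
      }

  -- Since reversal is an involution, ψ ^ F itself can serve as the LP-USO, and no orientation has
  -- to be built from reduced costs.
  game⇒LP-USO : ∀ {n} {b : Fin n → ℕ} {ψ : Orientation (b +𝟏)} → ArisesFromNondegenerateGame ℝ ψ →
    Σ[ φ ∈ Orientation (b +𝟏) ] Σ[ F ∈ Subset n ] (IsLPUSO ℝ φ × ψ ≐ φ ^ F)
  game⇒LP-USO {ψ = ψ} arises = ψ ^ F , F , ψ^F-LPUSO , ^-involutive {φ = ψ} F
    where open FromGame ψ arises

  -- Scaling the rows of H to row sum 1 − γ, for γ close enough to 1 that the
  -- diagonal entries are at most 1, gives a matrix of the form I − γP.
  module Normalise {n} {I : Set} (block : I → Fin n)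
    (H : I → Fin n → Carrier) (offdiag : ∀ x k → block x ≢ k → H x k ≤ 0#) (row-pos : ∀ x → 0# < sum (H x))
    (K : Carrier) (1<K : 1# < K) (diag≤K : ∀ x → H x (block x) * recip (row-pos x) ≤ K) where

    K-pos : 0# < K
    K-pos = <-trans 0<1 1<K

    -- The scaled rows sum to κ = 1 - γ. From 1 < K it follows that γ > 0, so P is obtained by
    -- dividing by γ; the bound on the diagonal keeps its scaled entries at most κK = 1.
    κ γ : Carrier
    κ = recip K-pos
    γ = 1# - κ

    κ-pos : 0# < κ
    κ-pos = recip-pos K-pos

    γ<1 : γ < 1#
    γ<1 = <-respʳ-≈ (trans (+-congˡ -0#≈0#) (+-identityʳ 1#)) (+-monoʳ-< 1# (neg-antimono-< κ-pos))

    γ-pos : 0# < γ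
    γ-pos = x<y⇒0<y-x (<-respˡ-≈ (*-identityʳ κ) (<-respʳ-≈ (trans (*-comm κ K) (*-recip K-pos)) (*-monoˡ-< κ-pos 1<K)))

    d : I → Carrier
    d x = κ * recip (row-pos x)

    d-pos : ∀ x → 0# < d x
    d-pos x = *-pos κ-pos (recip-pos (row-pos x))

    P : I → Fin n → Carrier
    P x k = (𝟙 ℝ (block x) k - d x * H x k) * recip γ-pos

    𝟙-γP≈dH : ∀ x k → 𝟙 ℝ (block x) k - γ * P x k ≈ d x * H x k
    𝟙-γP≈dH x k = begin
      𝟙 ℝ j k - γ * P x k                          ≈⟨ +-congˡ (-‿cong γP≈) ⟩
      𝟙 ℝ j k - (𝟙 ℝ j k - d x * H x k)            ≈⟨ +-congˡ (⁻¹-anti-homo‿- _ _) ⟩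
      𝟙 ℝ j k + (d x * H x k - 𝟙 ℝ j k)            ≈⟨ +-comm _ _ ⟩
      d x * H x k - 𝟙 ℝ j k + 𝟙 ℝ j k              ≈⟨ [x-y]+y≈x _ _ ⟩
      d x * H x k                                  ∎
      where
      open SetoidReasoning setoid
      j : Fin n
      j = block x
      γP≈ : γ * P x k ≈ 𝟙 ℝ j k - d x * H x k
      γP≈ = begin
        γ * ((𝟙 ℝ j k - d x * H x k) * recip γ-pos)     ≈⟨ *-congˡ (*-comm _ _) ⟩
        γ * (recip γ-pos * (𝟙 ℝ j k - d x * H x k))     ≈⟨ *-assoc _ _ _ ⟨
        γ * recip γ-pos * (𝟙 ℝ j k - d x * H x k)       ≈⟨ *-congʳ (*-recip γ-pos) ⟩
        1# * (𝟙 ℝ j k - d x * H x k)                    ≈⟨ *-identityˡ _ ⟩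
        𝟙 ℝ j k - d x * H x k                           ∎

    P≥0 : ∀ x k → 0# ≤ P x k
    P≥0 x k = *-nonneg (x≤y⇒0≤y-x dH≤𝟙) (inj₁ (recip-pos γ-pos))
      where
      open ≤-Reasoning
      dH≤𝟙 : d x * H x k ≤ 𝟙 ℝ (block x) k
      dH≤𝟙 with block x ≟ k
      ... | no j≢k     = ≤-trans (*-monoˡ-≤ (inj₁ (d-pos x)) (offdiag x k j≢k)) (≤-reflexive (zeroʳ _))
      ... | yes ≡.refl = begin
        κ * recip (row-pos x) * H x k        ≈⟨ *-assoc _ _ _ ⟩
        κ * (recip (row-pos x) * H x k)      ≈⟨ *-congˡ (*-comm _ _) ⟩
        κ * (H x k * recip (row-pos x))      ≤⟨ *-monoˡ-≤ (inj₁ κ-pos) (diag≤K x) ⟩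
        κ * K                                ≈⟨ *-comm κ K ⟩
        K * κ                                ≈⟨ *-recip K-pos ⟩
        1#                                   ∎

    P-sum : ∀ x → sum (P x) ≈ 1#
    P-sum x = begin
      sum (P x)                                                        ≈⟨ *-distribʳ-sum (recip γ-pos) (λ k → 𝟙 ℝ j k - d x * H x k) ⟨
      sum (λ k → 𝟙 ℝ j k - d x * H x k) * recip γ-pos                  ≈⟨ *-congʳ sum≈γ ⟩
      γ * recip γ-pos                                                  ≈⟨ *-recip γ-pos ⟩
      1#                                                               ∎
      where
      open SetoidReasoning setoid
      j : Fin n
      j = block x
      dσ≈κ : d x * sum (H x) ≈ κ
      dσ≈κ = trans (*-assoc _ _ _) (trans (*-congˡ (trans (*-comm _ _) (*-recip (row-pos x)))) (*-identityʳ κ))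
      sum≈γ : sum (λ k → 𝟙 ℝ j k - d x * H x k) ≈ γ
      sum≈γ = begin
        sum (λ k → 𝟙 ℝ j k - d x * H x k)                              ≈⟨ sum-cong-≋ (λ k → +-cong (sym (*-identityʳ (𝟙 ℝ j k))) (-‿distribˡ-* (d x) (H x k))) ⟩
        sum (λ k → 𝟙 ℝ j k * 1# + - d x * H x k)                       ≈⟨ ∑-distrib-+ (λ k → 𝟙 ℝ j k * 1#) (λ k → - d x * H x k) ⟩
        sum (λ k → 𝟙 ℝ j k * 1#) + sum (λ k → - d x * H x k)           ≈⟨ +-cong (∑-𝟙 j (λ _ → 1#)) (sym (*-distribˡ-sum (- d x) (H x))) ⟩
        1# + - d x * sum (H x)                                         ≈⟨ +-congˡ (-‿distribˡ-* (d x) (sum (H x))) ⟨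
        1# - d x * sum (H x)                                           ≈⟨ +-congˡ (-‿cong dσ≈κ) ⟩
        γ                                                              ∎

  -- From a grid LP to a game

  module FromLP {n} {b : Fin n → ℕ} {φ : Orientation (b +𝟏)} (φ-LPUSO : IsLPUSO ℝ φ) (F : Subset n) where
    open IsLPUSO φ-LPUSO
    open GridLP lp
    open GridLPProperties lp

    R-last : ∀ i (v : Fin n → Carrier) → dot (R (last {b = b} i)) v ≈ v i
    R-last i v = trans (dot-congˡ v (rows-last M i)) (∑-𝟙 i v)

    optimal : ∀ (c : N (b +𝟏) → Carrier) → ∃ λ B → ∀ x → dot (R x) (dual c B) ≤ c x
    optimal c = let B , _ , opt = optimum c (dual c) (dual-basic c) (λ _ → ⊤) (top , λ _ → ∈⊤)
                in B , λ (j , i) → opt j i ∈⊤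

    -- At the vertex of the slack columns the basis matrix is the identity, so p is the basic
    -- solution there.
    p-pos : ∀ i → 0# < p i
    p-pos i = <-respʳ-≈ eq (feasible top i)
      where
      open SetoidReasoning setoid
      eq : primal top i ≈ p i
      eq = begin
        primal top i                                        ≈⟨ ∑-𝟙ʳ i (primal top) ⟨
        sum (λ j → primal top j * 𝟙 ℝ j i)                  ≈⟨ sum-cong-≋ (λ j → *-congˡ (rows-last M j i)) ⟨
        sum (λ j → primal top j * R (basic top j) i)        ≈⟨ primal-feasible top i ⟩
        p i                                                 ∎

    blockCost : Fin n → N (b +𝟏) → Carrier
    blockCost j x = 𝟙 ℝ j (proj₁ x)

    -- y j is the dual optimum for minimising the total weight of block j.
    y : Fin n → Fin n → Carrier
    y j = dual (blockCost j) (proj₁ (optimal (blockCost j)))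

    Ry≤𝟙 : ∀ x j → dot (R x) (y j) ≤ 𝟙 ℝ j (proj₁ x)
    Ry≤𝟙 x j = proj₂ (optimal (blockCost j)) x

    y-offdiag : ∀ j i → j ≢ i → y j i ≤ 0#
    y-offdiag j i j≢i = begin
      y j i                        ≈⟨ R-last i (y j) ⟨
      dot (R (last i)) (y j)       ≤⟨ Ry≤𝟙 (last i) j ⟩
      𝟙 ℝ j i                      ≈⟨ diag-other _ j≢i ⟩
      0#                           ∎
      where open ≤-Reasoning

    -- The last rows of R are unit rows, so R y j ≤ 0 outside block j already bounds the
    -- off-diagonal entries. The product of y j with p is the optimal cost for block j, which is the
    -- single entry of a basic solution in that block, hence positive.
    y-isM : IsMMatrix y p
    y-isM = record
      { offdiag = y-offdiag
      ; x-pos   = p-pos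
      ; Wx-pos  = λ j → <-respʳ-≈ (sym (yp≈ j)) (feasible (B j) j)
      }
      where
      open SetoidReasoning setoid
      B : Fin n → Vertex (b +𝟏)
      B j = proj₁ (optimal (blockCost j))
      yp≈ : ∀ j → dot (y j) p ≈ primal (B j) j
      yp≈ j = begin
        dot (y j) p                                                          ≈⟨ dot-comm (y j) p ⟩
        dot p (y j)                                                          ≈⟨ objective (B j) (y j) ⟩
        sum (λ l → primal (B j) l * dot (R (basic (B j) l)) (y j))           ≈⟨ sum-cong-≋ (λ l → *-congˡ (trans (dual-basic (blockCost j) (B j) l) (𝟙-sym j l))) ⟩
        sum (λ l → primal (B j) l * 𝟙 ℝ l j)                                 ≈⟨ ∑-𝟙ʳ j (primal (B j)) ⟩
        primal (B j) j                                                       ∎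

    u : Fin n → Carrier
    u i = - dual (λ _ → - 1#) (proj₁ (optimal (λ _ → - 1#))) i

    Ru-pos : ∀ x → 0# < dot (R x) u
    Ru-pos x = <-≤-trans 0<1 (begin
      1#                                       ≈⟨ -‿involutive 1# ⟨
      - - 1#                                   ≤⟨ neg-antimono-≤ (proj₂ (optimal (λ _ → - 1#)) x) ⟩
      - dot (R x) (dual (λ _ → - 1#) _)        ≈⟨ dot-neg (R x) _ ⟨
      dot (R x) u                              ∎)
      where open ≤-Reasoning

    y⁻¹ : Inverse ℝ y
    y⁻¹ = M-matrix-inverse y-isM

    t : Fin n → Carrier
    t j = sum λ i → Inverse.mat y⁻¹ i j * u i

    yt≈u : ∀ i → dot (λ j → y j i) t ≈ u i
    yt≈u i = begin
      dot (λ j → y j i) t                                                  ≈⟨ ∑-assoc (λ j → y j i) (λ j k → Inverse.mat y⁻¹ k j) u ⟩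
      sum (λ k → sum (λ j → y j i * Inverse.mat y⁻¹ k j) * u k)            ≈⟨ dot-congˡ u (λ k → Inverse.invʳ (transpose-inverse y⁻¹) i k) ⟩
      dot (𝟙 ℝ i) u                                                        ≈⟨ ∑-𝟙 i u ⟩
      u i                                                                  ∎
      where open SetoidReasoning setoid

    u-pos : ∀ i → 0# < u i
    u-pos i = <-respʳ-≈ (R-last i u) (Ru-pos (last i))

    -- Y⁻¹ ≥ 0 and u > 0 give t ≥ 0. No entry vanishes because Yt = u is positive and Y has
    -- nonpositive off-diagonal entries.
    t-pos : ∀ j → 0# < t j
    t-pos j = strictly-monotone {W = λ i j → y j i} (λ i j i≢j → y-offdiag j i (i≢j ∘ ≡.sym))
      (λ j → sum-nonneg λ i → *-nonneg (M-matrix-inverse-nonneg y-isM y⁻¹ i j) (inj₁ (u-pos i)))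
      j (<-respʳ-≈ (sym (yt≈u j)) (u-pos j))

    H : N (b +𝟏) → Fin n → Carrier
    H x k = dot (R x) (y k) * t k

    H-offdiag : ∀ x k → proj₁ x ≢ k → H x k ≤ 0#
    H-offdiag x k j≢k = *-nonpos-nonneg
      (≤-trans (Ry≤𝟙 x k) (≤-reflexive (diag-other _ (j≢k ∘ ≡.sym)))) (inj₁ (t-pos k))

    -- The row sums of R Y diag(t) are the entries of R(Yt), and Yt = u.
    H-sum : ∀ x → sum (H x) ≈ dot (R x) u
    H-sum x = trans (sym (∑-assoc (R x) (λ i k → y k i) t)) (dot-congʳ (R x) yt≈u)

    H-row-pos : ∀ x → 0# < sum (H x)
    H-row-pos x = <-respʳ-≈ (sym (H-sum x)) (Ru-pos x)

    δ : N (b +𝟏) → Carrier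
    δ x = H x (proj₁ x) * recip (H-row-pos x)

    H-diag-nonneg : ∀ x → 0# ≤ H x (proj₁ x)
    H-diag-nonneg x = nonpos-others⇒nonneg (proj₁ x) (H-offdiag x) (H-row-pos x)

    δ-nonneg : ∀ x → 0# ≤ δ x
    δ-nonneg x = *-nonneg (H-diag-nonneg x) (inj₁ (recip-pos (H-row-pos x)))

    -- A sum of nonnegative terms bounds each of them and replaces a maximum; the summand 2 keeps K
    -- above 1 even if the sum is zero.
    K : Carrier
    K = (1# + 1#) + sum λ j → sum λ i → δ (j , i)

    δ-sum-nonneg : ∀ j → 0# ≤ sum (λ i → δ (j , i))
    δ-sum-nonneg j = sum-nonneg λ i → δ-nonneg (j , i)

    1<K : 1# < K
    1<K = begin-strict
      1#                ≈⟨ +-identityʳ 1# ⟨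
      1# + 0#           <⟨ +-monoʳ-< 1# 0<1 ⟩
      1# + 1#           ≈⟨ +-identityʳ _ ⟨
      1# + 1# + 0#      ≤⟨ +-monoʳ-≤ _ (sum-nonneg δ-sum-nonneg) ⟩
      K                 ∎
      where open ≤-Reasoning

    δ≤K : ∀ x → δ x ≤ K
    δ≤K (j , i) = begin
      δ (j , i)                              ≤⟨ term≤sum (λ i → δ-nonneg (j , i)) i ⟩
      sum (λ i → δ (j , i))                  ≤⟨ term≤sum δ-sum-nonneg j ⟩
      sum (λ j → sum (λ i → δ (j , i)))      ≈⟨ +-identityˡ _ ⟨
      0# + sum (λ j → sum (λ i → δ (j , i))) ≤⟨ +-monoˡ-≤ _ (+-nonneg 0≤1 0≤1) ⟩
      K                                      ∎
      where open ≤-Reasoning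

    open Normalise proj₁ H H-offdiag H-row-pos K 1<K δ≤K

    owner : Fin n → Player
    owner j with j ∈? F
    ... | yes _ = min
    ... | no  _ = max

    ∈F⇒min : ∀ {j} → j ∈ F → owner j ≡ min
    ∈F⇒min {j} j∈F with j ∈? F
    ... | yes _  = ≡.refl
    ... | no j∉F = contradiction j∈F j∉F

    ∉F⇒max : ∀ {j} → j ∉ F → owner j ≡ max
    ∉F⇒max {j} j∉F with j ∈? F
    ... | yes j∈F = contradiction j∈F j∉F
    ... | no _    = ≡.refl

    game : Game ℝ (b +𝟏)
    game = record
      { owner = owner
      -- The cost is zero on the last actions, so r_C = 0 and q′ = - r_C̅. The sign and the factor d
      -- turn q′ into the cost of the grid LP, scaled like the rows of R.
      ; r     = λ x → - (d x * cost x)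
      ; P     = P
      ; P≥0   = P≥0
      ; P-sum = P-sum
      ; γ     = γ
      ; 0≤γ   = inj₁ γ-pos
      ; γ<1   = γ<1
      }

    open GameMatrices ℝ game using (P-C; M′; q′; q″; r-C; r-C̅; [I∣-M″])
    module G = GameProperties game

    V : Inverse ℝ (_⊖_ ℝ (𝟙 ℝ) (_⊙_ ℝ γ P-C))
    V = M-matrix-inverse (G.L-isM top)

    scale ρ : Fin n → Carrier
    scale j = d (last j)
    ρ j = recip (d-pos (last j))

    -- The game matrix I − γP is DRYT with Y = (y j i)ᵀ and T = diag t, and R is
    -- the identity on the last actions, so L L_C⁻¹ = D R D_C⁻¹.
    G-rows : ∀ x i → G.R V x i ≈ d x * (R x i * ρ i)
    G-rows x i = begin
      G.R V x i                                                                   ≈⟨ G.rows-M′ V x i ⟩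
      sum (λ k → G.L x k * mat k i)                                               ≈⟨ sum-cong-≋ (λ k → *-congʳ (gL≈ k)) ⟨
      sum (λ k → sum (λ j → g j * G.L (last {b = b} j) k) * mat k i)              ≈⟨ ∑-assoc g (G.L ∘ last) (λ k → mat k i) ⟨
      sum (λ j → g j * sum (λ k → G.L (last {b = b} j) k * mat k i))              ≈⟨ sum-cong-≋ (λ j → *-congˡ (invʳ j i)) ⟩
      sum (λ j → g j * 𝟙 ℝ j i)                                                   ≈⟨ ∑-𝟙ʳ i g ⟩
      g i                                                                         ∎
      where
      open SetoidReasoning setoid
      open Inverse V
      g : Fin n → Carrier
      g j = d x * (R x j * ρ j)
      term : ∀ k j → g j * G.L (last {b = b} j) k ≈ d x * ((R x j * y k j) * t k)
      term k j = begin
        d x * (R x j * ρ j) * G.L (last j) k                       ≈⟨ *-congˡ (𝟙-γP≈dH (last j) k) ⟩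
        d x * (R x j * ρ j) * (scale j * H (last j) k)             ≈⟨ *-congˡ (*-congˡ (*-congʳ (R-last j (y k)))) ⟩
        d x * (R x j * ρ j) * (scale j * (y k j * t k))            ≈⟨ *-assoc _ _ _ ⟩
        d x * (R x j * ρ j * (scale j * (y k j * t k)))            ≈⟨ *-congˡ (*-assoc _ _ _) ⟩
        d x * (R x j * (ρ j * (scale j * (y k j * t k))))          ≈⟨ *-congˡ (*-congˡ (*-assoc _ _ _)) ⟨
        d x * (R x j * (ρ j * scale j * (y k j * t k)))            ≈⟨ *-congˡ (*-congˡ (*-congʳ (trans (*-comm _ _) (*-recip (d-pos (last j)))))) ⟩
        d x * (R x j * (1# * (y k j * t k)))                       ≈⟨ *-congˡ (*-congˡ (*-identityˡ _)) ⟩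
        d x * (R x j * (y k j * t k))                              ≈⟨ *-congˡ (*-assoc _ _ _) ⟨
        d x * (R x j * y k j * t k)                                ∎
      gL≈ : ∀ k → sum (λ j → g j * G.L (last {b = b} j) k) ≈ G.L x k
      gL≈ k = begin
        sum (λ j → g j * G.L (last j) k)                           ≈⟨ sum-cong-≋ (term k) ⟩
        sum (λ j → d x * (R x j * y k j * t k))                    ≈⟨ *-distribˡ-sum (d x) (λ j → R x j * y k j * t k) ⟨
        d x * sum (λ j → R x j * y k j * t k)                      ≈⟨ *-congˡ (*-distribʳ-sum (t k) (λ j → R x j * y k j)) ⟨
        d x * H x k                                                ≈⟨ 𝟙-γP≈dH x k ⟨
        G.L x k                                                    ∎

    q′≈dq : ∀ x → q′ V x ≈ d (inject x) * cost (inject x)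
    q′≈dq x = begin
      sum (λ j → M′ V x j * r-C j) - r-C̅ x           ≈⟨ +-cong (sum-zero λ j → trans (*-congˡ (r-C≈0 j)) (zeroʳ _)) (-‿involutive _) ⟩
      0# + d (inject x) * cost (inject x)            ≈⟨ +-identityˡ _ ⟩
      d (inject x) * cost (inject x)                 ∎
      where
      open SetoidReasoning setoid
      r-C≈0 : ∀ j → r-C j ≈ 0#
      r-C≈0 j = trans (-‿cong (trans (*-congˡ (reflexive ([∣]-last q (λ _ → 0#) j))) (zeroʳ _))) -0#≈0#

    game-cost : N (b +𝟏) → Carrier
    game-cost = [_∣_]ᵛ ℝ (q′ V) (λ _ → 0#)

    game-cost≈ : ∀ x → game-cost x ≈ d x * cost x
    game-cost≈ (j , i) = top-elim (λ i → game-cost (j , i) ≈ d (j , i) * cost (j , i))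
      (trans (reflexive ([∣]-last (q′ V) (λ _ → 0#) j))
        (sym (trans (*-congˡ (reflexive ([∣]-last q (λ _ → 0#) j))) (zeroʳ _))))
      (λ i → trans (reflexive ([∣]-inject (q′ V) (λ _ → 0#) (j , i))) (q′≈dq (j , i)))
      i

    -- With D the row scaling by d, the matrix of the game is D R D_C⁻¹. The factor D_C on the dual
    -- vector cancels D_C⁻¹, so the residuals of the grid LP are merely multiplied by D.
    game-dual : Vertex (b +𝟏) → Fin n → Carrier
    game-dual B j = scale j * dual cost B j

    G-rows-dual : ∀ B x → dot (G.R V x) (game-dual B) ≈ d x * dot (R x) (dual cost B)
    G-rows-dual B x = begin
      dot (G.R V x) (game-dual B)                                    ≈⟨ dot-congˡ (game-dual B) (G-rows x) ⟩
      sum (λ j → d x * (R x j * ρ j) * (scale j * z j))              ≈⟨ sum-cong-≋ term ⟩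
      sum (λ j → d x * (R x j * z j))                                ≈⟨ *-distribˡ-sum (d x) (λ j → R x j * z j) ⟨
      d x * dot (R x) z                                              ∎
      where
      open SetoidReasoning setoid
      z : Fin n → Carrier
      z = dual cost B
      term : ∀ j → d x * (R x j * ρ j) * (scale j * z j) ≈ d x * (R x j * z j)
      term j = begin
        d x * (R x j * ρ j) * (scale j * z j)       ≈⟨ *-assoc _ _ _ ⟩
        d x * (R x j * ρ j * (scale j * z j))       ≈⟨ *-congˡ (*-assoc _ _ _) ⟩
        d x * (R x j * (ρ j * (scale j * z j)))     ≈⟨ *-congˡ (*-congˡ (*-assoc _ _ _)) ⟨
        d x * (R x j * (ρ j * scale j * z j))       ≈⟨ *-congˡ (*-congˡ (*-congʳ (trans (*-comm _ _) (*-recip (d-pos (last j)))))) ⟩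
        d x * (R x j * (1# * z j))                  ≈⟨ *-congˡ (*-congˡ (*-identityˡ _)) ⟩
        d x * (R x j * z j)                         ∎

    open Complementarity (M′ V) (sign ℝ ∘ owner) (sign² ∘ owner)
      using (complementary-solution; residual; columns-inverse)

    [I∣-M″]⁻¹ : ∀ B → Inverse ℝ (columns ℝ ([I∣-M″] V) (nonbasic B))
    [I∣-M″]⁻¹ B = columns-inverse B (G.R-solvable V B) (G.R-injective V B)

    value : Vertex (b +𝟏) → N b → Carrier
    value B = _⊗ᵛ_ ℝ (Inverse.mat ([I∣-M″]⁻¹ B)) (q″ V)

    residual≈ : ∀ B k → residual B (q′ V) (game-dual B) (nonbasic B k) ≈ d (nonbasic B k) * reducedCost B k
    residual≈ B k = begin
      game-cost x - dot (G.R V x) (game-dual B)           ≈⟨ +-cong (game-cost≈ x) (-‿cong (G-rows-dual B x)) ⟩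
      d x * cost x - d x * dot (R x) (dual cost B)        ≈⟨ x[y-z]≈xy-xz _ _ _ ⟨
      d x * (cost x - dot (R x) (dual cost B))            ≈⟨ *-congˡ (trans (+-congʳ (sym (reducedCost-dual B k))) ([x+y]-y≈x _ _)) ⟩
      d x * reducedCost B k                               ∎
      where
      open SetoidReasoning setoid
      x : N (b +𝟏)
      x = nonbasic B k

    value≈ : ∀ B k → value B k ≈ sign ℝ (owner (proj₁ k)) * (d (nonbasic B k) * reducedCost B k)
    value≈ B k = trans
      (complementary-solution B (q′ V) (game-dual B)
        (λ j → trans (G-rows-dual B (basic B j)) (trans (*-congˡ (dual-basic cost B j)) (sym (game-cost≈ (basic B j)))))
        ([I∣-M″]⁻¹ B) (q″ V) (G.q″≈sq′ V) k)
      (*-congˡ (residual≈ B k))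

    φ^F-induced : IsInduced (φ ^ F) value
    φ^F-induced = IsInduced-^ F owner ∈F⇒min ∉F⇒max value≈
      (IsInduced-scale (λ B k → d (nonbasic B k)) (λ B k → d-pos (nonbasic B k)) (λ _ _ → refl)
        (record { nonzero = dualNondegenerate ; induced = induced }))

    arises : ∀ {ψ} → ψ ≐ φ ^ F → ArisesFromNondegenerateGame ℝ ψ
    arises {ψ} ψ≐φ^F = record
      { game          = game
      ; [I-γP-C]⁻¹    = V
      ; [I∣-M″]⁻¹     = [I∣-M″]⁻¹
      ; nondegenerate = IsInduced.nonzero ψ-induced
      ; induced       = IsInduced.induced ψ-induced
      }
      where
      ψ-induced : IsInduced ψ value
      ψ-induced = IsInduced-≐ (λ B C → mk⇔ (Equivalence.from (ψ≐φ^F B C)) (Equivalence.to (ψ≐φ^F B C))) φ^F-induced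

  LP-USO⇒game : ∀ {n} {b : Fin n → ℕ} {φ ψ : Orientation (b +𝟏)} → IsLPUSO ℝ φ → (F : Subset n) →
    ψ ≐ φ ^ F → ArisesFromNondegenerateGame ℝ ψ
  LP-USO⇒game φ-LPUSO F = arises
    where open FromLP φ-LPUSO F

open import Data.Nat.Base using (_≤_)

proposition10p3 : ∀ {c ℓ} (ℝ : CompleteOrderedField c ℓ)
    (n : ℕ) (b : Fin n → ℕ) → (∀ j → 2 ≤ (b +𝟏) j) →
    (ψ : Orientation (b +𝟏)) →
    ArisesFromNondegenerateGame ℝ ψ ⇔
    (Σ[ φ ∈ Orientation (b +𝟏) ] Σ[ F ∈ Subset n ] (IsLPUSO ℝ φ × ψ ≐ φ ^ F))
proposition10p3 ℝ n b _ ψ = mk⇔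
  (GridLPsAndGames.game⇒LP-USO ℝ)
  (λ (φ , F , φ-LPUSO , ψ≐φ^F) → GridLPsAndGames.LP-USO⇒game ℝ φ-LPUSO F ψ≐φ^F)
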